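{- Let $\tau(n)$ be the number of T-toothpicks added at stage $n$ of the T-toothpick structure defined in the context, with $\tau(0)=0$. Then $\tau(1)=1$, $\tau(2)=3$, and for $n\ge3$, $$ \tau(n)=\frac23\left\{3^{\mathrm{wt}(n-1)}+3^{\mathrm{wt}(n-2)}\right\}+1. $$
   Context: A T-toothpick consists of three unit line segments forming a "T": a crossbar of length $2$ whose midpoint is called the midpoint of the T-toothpick, and a stem of length $1$ attached perpendicularly at that midpoint. It has three endpoints (the two ends of the crossbar and the free end of the stem); an endpoint is exposed if it is not the midpoint or an endpoint of any other T-toothpick. At stage $1$ place a single T-toothpick with its stem vertical and pointing downwards. At each stage $n\ge2$, at every exposed endpoint place a T-toothpick whose midpoint is at that endpoint and whose stem points away from the existing T-toothpick (the new crossbar being perpendicular to the segment ending at that point). $\mathrm{wt}(n)$ denotes the number of $1$'s in the binary expansion of $n$. -}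

module Defs where

open import Data.Nat using (ℕ; zero; suc; _+_; _%_; _/_)
open import Data.Integer using (ℤ; 0ℤ; 1ℤ; -_) renaming (_+_ to _+ℤ_)
import Data.Integer.Properties as ℤP
open import Data.Product using (_×_; _,_; proj₁; proj₂)
open import Data.Product.Properties using (≡-dec)
open import Data.List using (List; []; _∷_; _++_; map; filter; length)
open import Data.Bool.ListAction using (any)
open import Data.Bool using (Bool; true; false; not; _∨_)
open import Relation.Nullary using (does)
open import Relation.Nullary.Decidable using (¬?)
open import Relation.Binary.PropositionalEquality using (_≡_)

Pt : Set
Pt = ℤ × ℤ

_≟ₚ_ : (p q : Pt) → Relation.Nullary.Dec (p ≡ q)
_≟ₚ_ = ≡-dec ℤP._≟_ ℤP._≟_

_⊕_ : Pt → Pt → Pt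
(a , b) ⊕ (c , d) = (a +ℤ c , b +ℤ d)

data Dir : Set where
  up down left right : Dir

vec : Dir → Pt
vec up    = (0ℤ , 1ℤ)
vec down  = (0ℤ , - 1ℤ)
vec left  = (- 1ℤ , 0ℤ)
vec right = (1ℤ , 0ℤ)

rotL : Dir → Dir
rotL up = left
rotL left = down
rotL down = right
rotL right = up

rotR : Dir → Dir
rotR up = right
rotR right = down
rotR down = left
rotR left = up

record TT : Set where
  constructor mkTT
  field
    mid  : Pt
    stem : Dir
open TT public

-- The three endpoints of a T-toothpick, each paired with the direction
-- of the unit segment of the T ending at that endpoint (pointing outwards).
ends : TT → List (Pt × Dir)
ends (mkTT p d) = (p ⊕ vec d , d) ∷ (p ⊕ vec (rotL d) , rotL d) ∷ (p ⊕ vec (rotR d) , rotR d) ∷ []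

touches : TT → Pt → Bool
touches t q = does (mid t ≟ₚ q) ∨ any (λ e → does (proj₁ e ≟ₚ q)) (ends t)

exposedOf : List TT → TT → List (Pt × Dir)
exposedOf others t = filter (λ e → ¬? (Data.Bool._≟_ (any (λ s → touches s (proj₁ e)) others) true)) (ends t)

exposedAux : List TT → List TT → List (Pt × Dir)
exposedAux pre [] = []
exposedAux pre (t ∷ post) = exposedOf (pre ++ post) t ++ exposedAux (pre ++ t ∷ []) post

exposed : List TT → List (Pt × Dir)
exposed S = exposedAux [] S

-- New toothpick at exposed endpoint e whose segment ends there with outward
-- direction d: midpoint e, crossbar perpendicular to d, stem pointing along d
-- (away from the existing toothpick).
grow : List TT → List TT
grow S = map (λ e → mkTT (proj₁ e) (proj₂ e)) (exposed S)

initial : TT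
initial = mkTT (0ℤ , 0ℤ) down

structure : ℕ → List TT
structure zero = []
structure (suc zero) = initial ∷ []
structure (suc (suc n)) = structure (suc n) ++ grow (structure (suc n))

τ : ℕ → ℕ
τ zero = 0
τ (suc zero) = 1
τ (suc (suc n)) = length (grow (structure (suc n)))

-- binary weight: number of 1's in the binary expansion of n
-- (fuel m ≥ number of binary digits; fuel n suffices)
wtAux : ℕ → ℕ → ℕ
wtAux zero m = 0
wtAux (suc f) m = m % 2 + wtAux f (m / 2)

wt : ℕ → ℕ
wt n = wtAux n n

{-# OPTIONS --safe #-}
module Submission where

open import Defs
import Data.Bool as Bool
open import Data.Bool using (Bool; true)
open import Data.Bool.ListAction using (any)
open import Data.Bool.Properties using (T-≡)
open import Data.Empty using (⊥; ⊥-elim)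
import Data.Integer as ℤ
open import Data.Integer using (ℤ; 0ℤ; 1ℤ; -_; +_; -[1+_]; +0; +[1+_])
import Data.Integer.Properties as ℤP
open import Data.Integer.Tactic.RingSolver using (solve-∀)
open import Data.List using (List; []; _∷_; _++_; map; length)
open import Data.List.Membership.Propositional using (_∈_; find; lose)
open import Data.List.Membership.Propositional.Properties
  using (∈-map⁺; ∈-map⁻; ∈-++⁺ˡ; ∈-++⁺ʳ; ∈-++⁻; ∈-filter⁺; ∈-filter⁻)
open import Data.List.Membership.Propositional.Properties.WithK using (unique∧set⇒bag)
import Data.List.Properties as ListP
open import Data.List.Relation.Binary.BagAndSetEquality using (∼bag⇒↭)
open import Data.List.Relation.Binary.Permutation.Propositional.Properties using (↭-length)
open import Data.List.Relation.Unary.All using ([]; _∷_; lookup)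
open import Data.List.Relation.Unary.AllPairs using ([]; _∷_)
open import Data.List.Relation.Unary.Any using (here; there)
open import Data.List.Relation.Unary.Any.Properties using (any⁺; any⁻)
open import Data.List.Relation.Unary.Unique.Propositional using (Unique)
import Data.List.Relation.Unary.Unique.Propositional.Properties as UniqueP
open import Data.Nat using (ℕ; zero; suc; _+_; _*_; _∸_; _^_; _%_; _/_; _≤_; _<_; z≤n; s≤s)
open import Data.Nat.DivMod using (m*n%n≡0; m*n/n≡m; [m+kn]%n≡m%n; m/n<m; +-distrib-/-∣ʳ)
open import Data.Nat.Divisibility using (n∣m*n)
open import Data.Nat.Induction using (<-rec)
import Data.Nat.Properties as ℕP
import Data.Nat.Tactic.RingSolver as ℕSolver
open import Data.Product using (_×_; _,_; proj₁; proj₂; ∃; ∃₂)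
open import Data.Sum using (_⊎_; inj₁; inj₂)
open import Data.Unit using (⊤; tt)
open import Function.Base using (_∘_)
open import Function.Bundles using (mk⇔; Equivalence)
open import Relation.Binary.PropositionalEquality
  using (_≡_; _≢_; refl; sym; trans; cong; cong₂; subst; module ≡-Reasoning)
open import Relation.Nullary using (¬_; contradiction; Dec; yes; no; does)
open import Relation.Nullary.Decidable using (¬?; dec-true)

-- Whether a point receives a T-toothpick depends only on whether exactly one earlier
-- T-toothpick touches it, so the structure is made of pieces of the Ulam–Warburton
-- automaton (a lattice point is born when exactly one of its four neighbours is on).
-- That automaton is self-similar: its cells of time 2t are the doubles of those of time t,
-- and those of time 2t + 1 are the three neighbours of the latter, all but the one behind.
-- Hence, for t ≥ 1, an open quadrant has a(t) cells of time t with a(2t) = a(t) and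
-- a(2t + 1) = 3 a(t) + 2, that is 3 (a(t) + 1) = 3 ^ wt t.  For n ≥ 3, stage n consists of
-- three cells on the axes, two quadrants at time n − 1 below, and two at time n − 2 above,
-- each of the latter together with one cell on its vertical boundary line.

-- Exposure of an endpoint depends on every T-toothpick present, whereas self-similarity relates
-- whole generations; deriving the second from the first would be awkward. So self-similarity is
-- taken as the definition, `On`, and the growth rule is recovered from it. Two facts carry this.
-- Cells at neighbouring points are always parent and child (`adjacent`), so only its parent touches
-- a new cell's point before that cell is born. Conversely, a forward step from a cell leads either
-- to a cell of the next time or to a point that a second cell touches as well (`grow-On`). Both
-- facts pass to the T-toothpicks through the charts in `Cell`, and together they say that an
-- endpoint is exposed exactly when the next generation has a cell there. Hence the lists of the
-- structure enumerate cells without repetition, and their lengths may be computed from any other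
-- enumeration.

opp : Dir → Dir
opp up    = down
opp down  = up
opp left  = right
opp right = left

opp-involutive : ∀ d → opp (opp d) ≡ d
opp-involutive up    = refl
opp-involutive down  = refl
opp-involutive left  = refl
opp-involutive right = refl

opp-injective : ∀ {d e} → opp d ≡ opp e → d ≡ e
opp-injective {d} {e} eq = trans (sym (opp-involutive d)) (trans (cong opp eq) (opp-involutive e))

opp-flip : ∀ {d e} → d ≡ opp e → e ≡ opp d
opp-flip {e = e} refl = sym (opp-involutive e)

d≢opp-d : ∀ d → d ≢ opp d
d≢opp-d up    ()
d≢opp-d down  ()
d≢opp-d left  ()
d≢opp-d right ()

-- Case analysis by relative turn rather than by absolute direction lets one argument serve all four
-- orientations.
data Compare (d : Dir) : Dir → Set where
  same     : Compare d d
  opposite : Compare d (opp d)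
  turnL    : Compare d (rotL d)
  turnR    : Compare d (rotR d)

compare : ∀ d e → Compare d e
compare up    up    = same
compare up    down  = opposite
compare up    left  = turnL
compare up    right = turnR
compare down  up    = opposite
compare down  down  = same
compare down  left  = turnR
compare down  right = turnL
compare left  up    = turnR
compare left  down  = turnL
compare left  left  = same
compare left  right = opposite
compare right up    = turnL
compare right down  = turnR
compare right left  = opposite
compare right right = same

rotL≢ : ∀ d → rotL d ≢ d
rotL≢ up    ()
rotL≢ down  ()
rotL≢ left  ()
rotL≢ right ()

rotR≢ : ∀ d → rotR d ≢ d
rotR≢ up    ()
rotR≢ down  ()
rotR≢ left  ()
rotR≢ right ()

_≟_ : (d e : Dir) → Dec (d ≡ e)
d ≟ e with compare d e
... | same     = yes refl
... | opposite = no (d≢opp-d d)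
... | turnL    = no (λ eq → rotL≢ d (sym eq))
... | turnR    = no (λ eq → rotR≢ d (sym eq))

rotL≢rotR : ∀ d → rotL d ≢ rotR d
rotL≢rotR up    ()
rotL≢rotR down  ()
rotL≢rotR left  ()
rotL≢rotR right ()

rotL≢opp : ∀ d → rotL d ≢ opp d
rotL≢opp up    ()
rotL≢opp down  ()
rotL≢opp left  ()
rotL≢opp right ()

rotR≢opp : ∀ d → rotR d ≢ opp d
rotR≢opp up    ()
rotR≢opp down  ()
rotR≢opp left  ()
rotR≢opp right ()

-- Unit steps, doubling and parity.

⊕-assoc : ∀ p q r → (p ⊕ q) ⊕ r ≡ p ⊕ (q ⊕ r)
⊕-assoc (a , b) (c , d) (e , f) = cong₂ _,_ (ℤP.+-assoc a c e) (ℤP.+-assoc b d f)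

⊕-comm : ∀ p q → p ⊕ q ≡ q ⊕ p
⊕-comm (a , b) (c , d) = cong₂ _,_ (ℤP.+-comm a c) (ℤP.+-comm b d)

⊕-identityʳ : ∀ p → p ⊕ (0ℤ , 0ℤ) ≡ p
⊕-identityʳ (a , b) = cong₂ _,_ (ℤP.+-identityʳ a) (ℤP.+-identityʳ b)

vec-opp : ∀ d → vec d ⊕ vec (opp d) ≡ (0ℤ , 0ℤ)
vec-opp up    = refl
vec-opp down  = refl
vec-opp left  = refl
vec-opp right = refl

step-back : ∀ p d → (p ⊕ vec d) ⊕ vec (opp d) ≡ p
step-back p d = trans (⊕-assoc p (vec d) _) (trans (cong (p ⊕_) (vec-opp d)) (⊕-identityʳ p))

step-move : ∀ p q d → p ≡ q ⊕ vec d → q ≡ p ⊕ vec (opp d)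
step-move p q d refl = sym (step-back q d)

⊕-swapʳ : ∀ p q r → (p ⊕ q) ⊕ r ≡ (p ⊕ r) ⊕ q
⊕-swapʳ p q r = trans (⊕-assoc p q r) (trans (cong (p ⊕_) (⊕-comm q r)) (sym (⊕-assoc p r q)))

step-cancelʳ : ∀ p q d → p ⊕ vec d ≡ q ⊕ vec d → p ≡ q
step-cancelʳ p q d eq =
  trans (sym (step-back p d)) (trans (cong (_⊕ vec (opp d)) eq) (step-back q d))

step-cancelˡ : ∀ p {d e} → p ⊕ vec d ≡ p ⊕ vec e → d ≡ e
step-cancelˡ (a , b) {d} {e} eq = vec-injective d e (cong₂ _,_ (cancel a (cong proj₁ eq)) (cancel b (cong proj₂ eq)))
  where
  back : ∀ i j → - i ℤ.+ (i ℤ.+ j) ≡ j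
  back = solve-∀
  cancel : ∀ i {j k} → i ℤ.+ j ≡ i ℤ.+ k → j ≡ k
  cancel i {j} {k} h = trans (sym (back i j)) (trans (cong (λ k → - i ℤ.+ k) h) (back i k))
  vec-injective : ∀ d e → vec d ≡ vec e → d ≡ e
  vec-injective up    up    _  = refl
  vec-injective up    down  ()
  vec-injective up    left  ()
  vec-injective up    right ()
  vec-injective down  up    ()
  vec-injective down  down  _  = refl
  vec-injective down  left  ()
  vec-injective down  right ()
  vec-injective left  up    ()
  vec-injective left  down  ()
  vec-injective left  left  _  = refl
  vec-injective left  right ()
  vec-injective right up    ()
  vec-injective right down  ()
  vec-injective right left  ()
  vec-injective right right _  = refl

step-≢ : ∀ p d → p ⊕ vec d ≢ p
step-≢ p d eq = d≢opp-d d (step-cancelˡ p (trans eq (step-move p p d (sym eq))))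

dbl : Pt → Pt
dbl p = p ⊕ p

dbl-step : ∀ p d → dbl (p ⊕ vec d) ≡ (dbl p ⊕ vec d) ⊕ vec d
dbl-step (a , b) d = cong₂ _,_ (lem a (proj₁ (vec d))) (lem b (proj₂ (vec d)))
  where
  lem : ∀ i j → (i ℤ.+ j) ℤ.+ (i ℤ.+ j) ≡ ((i ℤ.+ i) ℤ.+ j) ℤ.+ j
  lem = solve-∀

double≢1 : ∀ i → i ℤ.+ i ≢ 1ℤ
double≢1 +0 ()
double≢1 +[1+ zero ] ()
double≢1 +[1+ suc n ] ()
double≢1 -[1+ n ] ()

double-minus : ∀ i j → (i ℤ.- j) ℤ.+ (i ℤ.- j) ≡ (i ℤ.+ i) ℤ.- (j ℤ.+ j)
double-minus = solve-∀

double+odd : ∀ i j → (i ℤ.+ i) ℤ.+ ((j ℤ.+ j) ℤ.+ 1ℤ) ≡ ((i ℤ.+ j) ℤ.+ (i ℤ.+ j)) ℤ.+ 1ℤ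
double+odd = solve-∀

even≢odd : ∀ i j → i ℤ.+ i ≢ (j ℤ.+ j) ℤ.+ 1ℤ
even≢odd i j eq = double≢1 (i ℤ.- j) (trans (double-minus i j) (trans (cong (λ k → k ℤ.- (j ℤ.+ j)) eq) (cancel j)))
  where
  cancel : ∀ j → ((j ℤ.+ j) ℤ.+ 1ℤ) ℤ.- (j ℤ.+ j) ≡ 1ℤ
  cancel = solve-∀

double-injective : ∀ {i j} → i ℤ.+ i ≡ j ℤ.+ j → i ≡ j
double-injective {i} {j} eq = ℤP.i-j≡0⇒i≡j i j (double≡0 (i ℤ.- j) (trans (double-minus i j) (ℤP.i≡j⇒i-j≡0 eq)))
  where
  double≡0 : ∀ k → k ℤ.+ k ≡ 0ℤ → k ≡ 0ℤ
  double≡0 +0 _ = refl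
  double≡0 +[1+ n ] ()
  double≡0 -[1+ n ] ()

dbl-injective : ∀ p q → dbl p ≡ dbl q → p ≡ q
dbl-injective p q eq = cong₂ _,_ (double-injective (cong proj₁ eq)) (double-injective (cong proj₂ eq))

total : Pt → ℤ
total (a , b) = a ℤ.+ b

total-⊕ : ∀ p q → total (p ⊕ q) ≡ total p ℤ.+ total q
total-⊕ (a , b) (c , d) = lem a b c d
  where
  lem : ∀ a b c d → (a ℤ.+ c) ℤ.+ (b ℤ.+ d) ≡ (a ℤ.+ b) ℤ.+ (c ℤ.+ d)
  lem = solve-∀

-- total (vec d) ≡ 2 · half d + 1, so every unit step changes the parity of total.
half : Dir → ℤ
half up    = 0ℤ
half down  = - 1ℤ
half left  = - 1ℤ
half right = 0ℤ

total-vec : ∀ d → total (vec d) ≡ (half d ℤ.+ half d) ℤ.+ 1ℤ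
total-vec up    = refl
total-vec down  = refl
total-vec left  = refl
total-vec right = refl

total-odd : ∀ p d → total (dbl p ⊕ vec d) ≡ ((total p ℤ.+ half d) ℤ.+ (total p ℤ.+ half d)) ℤ.+ 1ℤ
total-odd p d = trans (total-⊕ (dbl p) (vec d))
  (trans (cong₂ ℤ._+_ (total-⊕ p p) (total-vec d)) (double+odd (total p) (half d)))

dbl≢step : ∀ p q d → dbl p ≢ dbl q ⊕ vec d
dbl≢step p q d eq = even≢odd (total p) (total q ℤ.+ half d)
  (trans (sym (total-⊕ p p)) (trans (cong total eq) (total-odd q d)))

step≢step² : ∀ p q d e f → dbl p ⊕ vec d ≢ (dbl q ⊕ vec e) ⊕ vec f
step≢step² p q d e f eq = even≢odd ((total q ℤ.+ half e) ℤ.+ half f ℤ.+ 1ℤ) (total p ℤ.+ half d)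
  (trans (sym even) (trans (cong total (sym eq)) (total-odd p d)))
  where
  lem : ∀ i j → (i ℤ.+ i ℤ.+ 1ℤ) ℤ.+ ((j ℤ.+ j) ℤ.+ 1ℤ) ≡ (i ℤ.+ j ℤ.+ 1ℤ) ℤ.+ (i ℤ.+ j ℤ.+ 1ℤ)
  lem = solve-∀
  even : total ((dbl q ⊕ vec e) ⊕ vec f)
       ≡ ((total q ℤ.+ half e) ℤ.+ half f ℤ.+ 1ℤ) ℤ.+ ((total q ℤ.+ half e) ℤ.+ half f ℤ.+ 1ℤ)
  even = trans (total-⊕ (dbl q ⊕ vec e) (vec f))
    (trans (cong₂ ℤ._+_ (total-odd q e) (total-vec f)) (lem (total q ℤ.+ half e) (half f)))

-- The parity of `total` does not see two steps, so coordinates are needed: a turn makes one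
-- horizontal and one vertical step, and therefore changes the parity of each coordinate.
turn-odd : ∀ e f → f ≡ rotL e ⊎ f ≡ rotR e →
           ∃ λ h → proj₁ (vec e) ℤ.+ proj₁ (vec f) ≡ (h ℤ.+ h) ℤ.+ 1ℤ
turn-odd up    _ (inj₁ refl) = - 1ℤ , refl
turn-odd up    _ (inj₂ refl) = 0ℤ , refl
turn-odd down  _ (inj₁ refl) = 0ℤ , refl
turn-odd down  _ (inj₂ refl) = - 1ℤ , refl
turn-odd left  _ (inj₁ refl) = - 1ℤ , refl
turn-odd left  _ (inj₂ refl) = - 1ℤ , refl
turn-odd right _ (inj₁ refl) = 0ℤ , refl
turn-odd right _ (inj₂ refl) = 0ℤ , refl

dbl≢turn : ∀ p q e f → f ≡ rotL e ⊎ f ≡ rotR e → dbl p ≢ (dbl q ⊕ vec e) ⊕ vec f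
dbl≢turn (a , _) (b , _) e f turn eq with turn-odd e f turn
... | h , odd = even≢odd a (b ℤ.+ h)
  (trans (cong proj₁ eq) (trans (ℤP.+-assoc (b ℤ.+ b) _ _) (trans (cong (λ k → b ℤ.+ b ℤ.+ k) odd) (double+odd b h))))

dbl-step²⁻ : ∀ p q e f → dbl p ≡ (dbl q ⊕ vec e) ⊕ vec f →
             (f ≡ e × p ≡ q ⊕ vec e) ⊎ (f ≡ opp e × p ≡ q)
dbl-step²⁻ p q e f eq with compare e f
... | same     = inj₁ (refl , dbl-injective p (q ⊕ vec e) (trans eq (sym (dbl-step q e))))
... | opposite = inj₂ (refl , dbl-injective p q (trans eq (step-back (dbl q) e)))
... | turnL    = ⊥-elim (dbl≢turn p q e f (inj₁ refl) eq)
... | turnR    = ⊥-elim (dbl≢turn p q e f (inj₂ refl) eq)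

-- The point is the midpoint of the edge joining the doubles of `p` and `p ⊕ vec d`, so it can be
-- reached only from the two ends of that edge.
step-dbl⁻ : ∀ p q d e → dbl p ⊕ vec d ≡ dbl q ⊕ vec e →
            (d ≡ e × p ≡ q) ⊎ (e ≡ opp d × q ≡ p ⊕ vec d)
step-dbl⁻ p q d e eq with dbl-step²⁻ q p d (opp e) (step-move (dbl p ⊕ vec d) (dbl q) e eq)
... | inj₁ (h , q≡) = inj₂ (opp-flip (sym h) , q≡)
... | inj₂ (h , q≡) = inj₁ (sym (opp-injective h) , sym q≡)

odd≢even : ∀ m n → suc (m * 2) ≢ n * 2
odd≢even zero    (suc n) ()
odd≢even (suc m) (suc n) eq = odd≢even m n (ℕP.suc-injective (ℕP.suc-injective eq))

*2-injective : ∀ m n → m * 2 ≡ n * 2 → m ≡ n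
*2-injective m n = ℕP.*-cancelʳ-≡ m n 2

<⇒odd<even : ∀ {m n} → m < n → suc (m * 2) < n * 2
<⇒odd<even m<n = ℕP.*-monoˡ-≤ 2 m<n

≡⇒even<odd : ∀ {m n} → m ≡ n → m * 2 < suc (n * 2)
≡⇒even<odd refl = ℕP.≤-refl

-- The Ulam-Warburton automaton, read off from binary digits.

origin : Pt
origin = (0ℤ , 0ℤ)

-- On t p d: in the Ulam–Warburton automaton seeded at the origin, the cell p is born at
-- time t from p − d.  The derivation reads the binary digits of t from the leading one.
-- The seed carries every direction, since it grows to all four sides.
data On : ℕ → Pt → Dir → Set where
  seed : ∀ {d} → On 0 origin d
  even : ∀ {t p d} → On t p d → On (t * 2) (dbl p) d
  odd  : ∀ {t p d′ d} → On t p d′ → d ≢ opp d′ → On (suc (t * 2)) (dbl p ⊕ vec d) d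

-- For cells p = q + f born at times s and t with directions d and e: one of them is the
-- parent of the other, as far as direction and order of birth are concerned.
Adjacent : ℕ → Dir → ℕ → Dir → Dir → Set
Adjacent s d t e f = (t < s × f ≡ d) ⊎ (s < t × opp f ≡ e)

-- Both statements are proved together, by induction on the derivations. A doubled point is never an
-- edge midpoint, and two points of the same kind are never neighbours. What remains, a midpoint
-- reached from both ends of its edge or a midpoint next to a doubled point, comes from equal or
-- neighbouring cells one binary digit earlier, where the ban on growing backwards excludes the
-- unwanted cases.
uniqueTime : ∀ {s t p q d e} → On s p d → On t q e → p ≡ q → s ≡ t
adjacent : ∀ {s t p q d e} f → On s p d → On t q e → p ≡ q ⊕ vec f → Adjacent s d t e f

adjacent-odd-even : ∀ {s t p q d d′ e} f → On s p d′ → d ≢ opp d′ → On t q e →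
           dbl p ⊕ vec d ≡ dbl q ⊕ vec f → Adjacent (suc (s * 2)) d (t * 2) e f
adjacent-odd-even {p = p} {q} {d} {d′} {e} f D turn E eq with step-dbl⁻ p q d f eq
... | inj₁ (refl , p≡q) = inj₁ (≡⇒even<odd (sym (uniqueTime D E p≡q)) , refl)
... | inj₂ (refl , q≡) with adjacent (opp d) D E (step-move q p d q≡)
...   | inj₁ (_ , d≡) = contradiction (opp-flip (sym d≡)) turn
...   | inj₂ (s<t , d≡) = inj₂ (<⇒odd<even s<t , d≡)

adjacent-even-odd : ∀ {s t p q d e e′} f → On s p d → On t q e′ → e ≢ opp e′ →
           dbl p ≡ (dbl q ⊕ vec e) ⊕ vec f → Adjacent (s * 2) d (suc (t * 2)) e f
adjacent-even-odd {p = p} {q} {d} {e} f D E turn eq with dbl-step²⁻ p q e f eq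
... | inj₂ (refl , p≡q) = inj₂ (≡⇒even<odd (uniqueTime D E p≡q) , opp-involutive e)
... | inj₁ (refl , p≡) with adjacent e D E p≡
...   | inj₁ (t<s , e≡) = inj₁ (<⇒odd<even t<s , e≡)
...   | inj₂ (_ , e≡) = contradiction (opp-flip (sym e≡)) turn

uniqueTime-odd : ∀ {s t p q d d′ e e′} → On s p d′ → d ≢ opp d′ → On t q e′ → e ≢ opp e′ →
          dbl p ⊕ vec d ≡ dbl q ⊕ vec e → suc (s * 2) ≡ suc (t * 2)
uniqueTime-odd {p = p} {q} {d} {d′} {e} D turn E turn′ eq with step-dbl⁻ p q d e eq
... | inj₁ (_ , p≡q) = cong (λ r → suc (r * 2)) (uniqueTime D E p≡q)
... | inj₂ (refl , q≡) with adjacent (opp d) D E (step-move q p d q≡)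
...   | inj₁ (_ , d≡) = contradiction (opp-flip (sym d≡)) turn
...   | inj₂ (_ , d≡) = contradiction (cong opp (trans (sym (opp-involutive d)) d≡)) turn′

uniqueTime seed seed eq = refl
-- The seed counts as its own double, since `dbl origin` and `0 * 2` compute to `origin` and `0`;
-- only the other derivation shrinks.
uniqueTime D@seed (even {p = q} E) eq = cong (_* 2) (uniqueTime D E (dbl-injective origin q eq))
uniqueTime seed (odd {p = q} {d = e} _ _) eq = ⊥-elim (dbl≢step origin q e eq)
uniqueTime (even {p = p} D) E@seed eq = cong (_* 2) (uniqueTime D E (dbl-injective p origin eq))
uniqueTime (even {p = p} D) (even {p = q} E) eq = cong (_* 2) (uniqueTime D E (dbl-injective p q eq))
uniqueTime (even {p = p} D) (odd {p = q} {d = e} _ _) eq = ⊥-elim (dbl≢step p q e eq)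
uniqueTime (odd {p = p} {d = d} _ _) seed eq = ⊥-elim (dbl≢step origin p d (sym eq))
uniqueTime (odd {p = p} {d = d} _ _) (even {p = q} E) eq = ⊥-elim (dbl≢step q p d (sym eq))
uniqueTime (odd D turn) (odd E turn′) eq = uniqueTime-odd D turn E turn′ eq

adjacent f seed seed eq = ⊥-elim (dbl≢step origin origin f eq)
adjacent f seed (even {p = q} E) eq = ⊥-elim (dbl≢step origin q f eq)
adjacent f D@seed (odd E turn) eq = adjacent-even-odd f D E turn eq
adjacent f (even {p = p} D) seed eq = ⊥-elim (dbl≢step p origin f eq)
adjacent f (even {p = p} D) (even {p = q} E) eq = ⊥-elim (dbl≢step p q f eq)
adjacent f (even D) (odd E turn) eq = adjacent-even-odd f D E turn eq
adjacent f (odd D turn) E@seed eq = adjacent-odd-even f D turn E eq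
adjacent f (odd D turn) (even E) eq = adjacent-odd-even f D turn E eq
adjacent f (odd {p = p} {d = d} _ _) (odd {p = q} {d = e} _ _) eq = ⊥-elim (step≢step² p q d e f eq)

-- An edge midpoint grew from the doubled end of its edge; a doubled cell grew from the midpoint of
-- the edge that leads from the parent of the undoubled cell.
parent : ∀ {s p d} → On s p d → ∀ t → s ≡ suc t →
         ∃₂ λ q d′ → On t q d′ × d ≢ opp d′ × p ≡ q ⊕ vec d
parent (even {suc s} {p} {d} D) _ refl with parent D s refl
... | q , d′ , E , turn , refl = dbl q ⊕ vec d , d , odd E turn , d≢opp-d d , dbl-step q d
parent (odd {p = p} {d′} D turn) _ refl = dbl p , d′ , even D , turn , refl

uniqueDir : ∀ {t p d e} → On (suc t) p d → On (suc t) p e → d ≡ e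
uniqueDir {t} {p} {d} {e} D E with parent E t refl
... | q , e′ , E′ , turn , p≡ with adjacent e D E′ p≡
...   | inj₁ (_ , e≡d) = sym e≡d
...   | inj₂ (_ , e≡) = contradiction (opp-flip (sym e≡)) turn

Touch : Pt → Dir → Pt → Set
Touch q e p = q ≡ p ⊎ ∃ λ f → f ≢ opp e × q ⊕ vec f ≡ p

-- The cell predicate is a parameter because blocking is first proved for `On` and then carried over
-- to `Cell`.
Blocked : (ℕ → Pt → Dir → Set) → ℕ → Pt → Pt → Set
Blocked C s c p = ∃ λ t → ∃₂ λ q e → t ≤ s × C t q e × q ≢ c × Touch q e p

On-zero-turn : ∀ {t p d} e → On t p d → t ≡ 0 → On t p e
On-zero-turn e seed _ = seed
On-zero-turn e (even {zero} D) _ = even (On-zero-turn e D refl)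

-- The corner dbl c + d′ + d is also touched by the cell at dbl c + d, which is a child of
-- dbl c, or, if d points back to the parent of c, the cell through which dbl c was reached.
side-blocked : ∀ {t c d″ d′ d} → On t c d″ → d′ ≢ opp d″ → d ≢ d′ → d ≢ opp d′ →
       Blocked On (suc (t * 2)) (dbl c ⊕ vec d′) ((dbl c ⊕ vec d′) ⊕ vec d)
side-blocked {t} {c} {d″} {d′} {d} D turn d≢d′ perp = by-cases (d ≟ opp d″)
  where
  ≢c : dbl c ⊕ vec d ≢ dbl c ⊕ vec d′
  ≢c eq = d≢d′ (step-cancelˡ (dbl c) eq)
  blocked : ∀ {s e} → s ≤ suc (t * 2) → On s (dbl c ⊕ vec d) e → d′ ≢ opp e →
            Blocked On (suc (t * 2)) (dbl c ⊕ vec d′) ((dbl c ⊕ vec d′) ⊕ vec d)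
  blocked {s} {e} s≤ E d′≢ =
    s , dbl c ⊕ vec d , e , s≤ , E , ≢c , inj₂ (d′ , d′≢ , ⊕-swapʳ (dbl c) (vec d) (vec d′))
  child : ∀ {e} → On t c e → d ≢ opp e →
          Blocked On (suc (t * 2)) (dbl c ⊕ vec d′) ((dbl c ⊕ vec d′) ⊕ vec d)
  child E t≢ = blocked ℕP.≤-refl (odd E t≢) (λ eq → perp (opp-flip eq))
  behind : ∀ u → t ≡ u → d ≡ opp d″ →
           Blocked On (suc (t * 2)) (dbl c ⊕ vec d′) ((dbl c ⊕ vec d′) ⊕ vec d)
  -- At time zero there is no cell behind, but the seed carries every direction and so also has a
  -- child along `d`.
  behind zero t≡ _ = child (On-zero-turn d D t≡) (d≢opp-d d)
  behind (suc u) refl refl with parent D u refl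
  ... | q , e , E , turn′ , refl =
    blocked (ℕP.≤-trans (ℕP.n≤1+n _) (ℕP.n≤1+n _))
      (subst (λ r → On (suc (u * 2)) r d″) (sym point) (odd E turn′)) turn
    where
    point : dbl (q ⊕ vec d″) ⊕ vec (opp d″) ≡ dbl q ⊕ vec d″
    point = trans (cong (_⊕ vec (opp d″)) (dbl-step q d″)) (step-back (dbl q ⊕ vec d″) d″)
  by-cases : Dec (d ≡ opp d″) → Blocked On (suc (t * 2)) (dbl c ⊕ vec d′) ((dbl c ⊕ vec d′) ⊕ vec d)
  by-cases (no d≢)  = child D d≢
  by-cases (yes d≡) = behind t refl d≡

-- A doubled cell grows freely to the midpoints of its edges. From an edge midpoint a sideways step
-- is blocked, and a straight step reaches the double of `c ⊕ vec d`, so the question is the same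
-- one for `c`. A blocker `q` lying at that point is doubled; one that touches it along `f` is
-- replaced by the midpoint `dbl q ⊕ vec f`.
grow-On : ∀ {s c d′} d → On s c d′ → d ≢ opp d′ →
          On (suc s) (c ⊕ vec d) d ⊎ Blocked On s c (c ⊕ vec d)
grow-On d seed _ = inj₁ (odd (seed {d}) (d≢opp-d d))
grow-On d (even D) turn = inj₁ (odd D turn)
grow-On d (odd {t} {c} {d″} {d′} D turn) turn′ with d ≟ d′
... | no d≢d′ = inj₂ (side-blocked D turn d≢d′ turn′)
... | yes refl with grow-On d D turn
...   | inj₁ E = inj₁ (subst (λ p → On _ p d) (dbl-step c d) (even E))
...   | inj₂ (s , q , e , s≤ , E , q≢ , inj₁ refl) =
  inj₂ (s * 2 , dbl q , e , ℕP.m≤n⇒m≤1+n (ℕP.*-monoˡ-≤ 2 s≤) , even E ,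
        dbl≢step q c d , inj₁ (dbl-step c d))
...   | inj₂ (s , q , e , s≤ , E , q≢ , inj₂ (f , f≢ , touch)) =
  inj₂ (suc (s * 2) , dbl q ⊕ vec f , f , s≤s (ℕP.*-monoˡ-≤ 2 s≤) , odd E f≢ , ≢c ,
        inj₂ (f , d≢opp-d f , trans (sym (dbl-step q f)) (trans (cong dbl touch) (dbl-step c d))))
  where
  ≢c : dbl q ⊕ vec f ≢ dbl c ⊕ vec d
  ≢c eq with step-dbl⁻ q c f d eq
  ... | inj₁ (_ , q≡c) = q≢ q≡c
  ... | inj₂ (refl , c≡) = step-≢ c (opp f) (sym (trans c≡ touch))

-- Reflections of the automaton.

record Symmetry : Set where
  field
    pt       : Pt → Pt
    dir      : Dir → Dir
    pt-⊕     : ∀ p q → pt (p ⊕ q) ≡ pt p ⊕ pt q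
    pt-o     : pt origin ≡ origin
    pt-vec   : ∀ d → pt (vec d) ≡ vec (dir d)
    dir-opp  : ∀ d → dir (opp d) ≡ opp (dir d)
    dir-inv  : ∀ d → dir (dir d) ≡ d
    pt-inv   : ∀ p → pt (pt p) ≡ p

  dir-injective : ∀ {d e} → dir d ≡ dir e → d ≡ e
  dir-injective {d} {e} eq = trans (sym (dir-inv d)) (trans (cong dir eq) (dir-inv e))

  dir-≢opp : ∀ {d e} → d ≢ opp e → dir d ≢ opp (dir e)
  dir-≢opp {e = e} d≢ eq = d≢ (dir-injective (trans eq (sym (dir-opp e))))

  pt-step : ∀ p d → pt (p ⊕ vec d) ≡ pt p ⊕ vec (dir d)
  pt-step p d = trans (pt-⊕ p (vec d)) (cong (pt p ⊕_) (pt-vec d))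

  pt-injective : ∀ {p q} → pt p ≡ pt q → p ≡ q
  pt-injective {p} {q} eq = trans (sym (pt-inv p)) (trans (cong pt eq) (pt-inv q))

  On-symmetric : ∀ {t p d} → On t p d → On t (pt p) (dir d)
  On-symmetric {d = d} seed = subst (λ p → On 0 p (dir d)) (sym pt-o) seed
  On-symmetric {d = d} (even {t} {p} D) =
    subst (λ q → On (t * 2) q (dir d)) (sym (pt-⊕ p p)) (even (On-symmetric D))
  On-symmetric {d = d} (odd {t} {p} D turn) =
    subst (λ q → On (suc (t * 2)) q (dir d))
      (sym (trans (pt-step (dbl p) d) (cong (_⊕ vec (dir d)) (pt-⊕ p p))))
      (odd (On-symmetric D) (dir-≢opp turn))

mirror : Dir → Dir
mirror up    = up
mirror down  = down
mirror left  = right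
mirror right = left

flipDir : Dir → Dir
flipDir up    = down
flipDir down  = up
flipDir left  = left
flipDir right = right

flipX : Symmetry
flipX = record
  { pt      = λ { (a , b) → (- a , b) }
  ; dir     = mirror
  ; pt-⊕    = λ { (a , b) (c , d) → cong (_, b ℤ.+ d) (ℤP.neg-distrib-+ a c) }
  ; pt-o    = refl
  ; pt-vec  = λ { up → refl ; down → refl ; left → refl ; right → refl }
  ; dir-opp = λ { up → refl ; down → refl ; left → refl ; right → refl }
  ; dir-inv = λ { up → refl ; down → refl ; left → refl ; right → refl }
  ; pt-inv  = λ { (a , b) → cong (_, b) (ℤP.neg-involutive a) }
  }

flipY : Symmetry
flipY = record
  { pt      = λ { (a , b) → (a , - b) }
  ; dir     = flipDir
  ; pt-⊕    = λ { (a , b) (c , d) → cong (a ℤ.+ c ,_) (ℤP.neg-distrib-+ b d) }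
  ; pt-o    = refl
  ; pt-vec  = λ { up → refl ; down → refl ; left → refl ; right → refl }
  ; dir-opp = λ { up → refl ; down → refl ; left → refl ; right → refl }
  ; dir-inv = λ { up → refl ; down → refl ; left → refl ; right → refl }
  ; pt-inv  = λ { (a , b) → cong (a ,_) (ℤP.neg-involutive b) }
  }

module FX = Symmetry flipX
module FY = Symmetry flipY

-- Binary recursion, the axes, and uniqueness away from the seed.

data Parity : ℕ → Set where
  isEven : ∀ m → Parity (m * 2)
  isOdd  : ∀ m → Parity (suc (m * 2))

parity : ∀ n → Parity n
parity zero = isEven 0
parity (suc n) with parity n
... | isEven m = isOdd m
... | isOdd m  = isEven (suc m)

-- The doubling step asks for a positive number because zero is its own double and would not
-- decrease.
binary-rec : (P : ℕ → Set) → P 0 → (∀ m → P (suc m) → P (suc m * 2)) →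
             (∀ m → P m → P (suc (m * 2))) → ∀ n → P n
binary-rec P p0 pe po = <-rec P step
  where
  step : ∀ n → (∀ {m} → m < n → P m) → P n
  step n rec with parity n
  ... | isEven zero    = p0
  ... | isEven (suc m) = pe m (rec (s≤s (s≤s (ℕP.m≤m*n m 2))))
  ... | isOdd m        = po m (rec (s≤s (ℕP.m≤m*n m 2)))

ray : ℕ → Dir → Pt
ray zero    d = origin
ray (suc n) d = ray n d ⊕ vec d

ray-dbl : ∀ n d → ray (n * 2) d ≡ dbl (ray n d)
ray-dbl zero    d = refl
ray-dbl (suc n) d = trans (cong (λ p → (p ⊕ vec d) ⊕ vec d) (ray-dbl n d)) (sym (dbl-step (ray n d) d))

On-ray : ∀ d t → On t (ray t d) d
On-ray d = binary-rec (λ t → On t (ray t d) d) seed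
  (λ m D → subst (λ p → On _ p d) (sym (ray-dbl (suc m) d)) (even D))
  (λ m D → subst (λ p → On _ (p ⊕ vec d) d) (sym (ray-dbl m d)) (odd D (d≢opp-d d)))

ray-right : ∀ n → ray n right ≡ (+ n , +0)
ray-right zero    = refl
ray-right (suc n) = trans (cong (_⊕ vec right) (ray-right n)) (cong (λ k → + k , +0) (ℕP.+-comm n 1))

ray-up : ∀ n → ray n up ≡ (+0 , + n)
ray-up zero    = refl
ray-up (suc n) = trans (cong (_⊕ vec up) (ray-up n)) (cong (λ k → +0 , + k) (ℕP.+-comm n 1))

On-right : ∀ t → On t (+ t , +0) right
On-right t = subst (λ p → On t p right) (ray-right t) (On-ray right t)

On-left : ∀ t → On t (- (+ t) , +0) left
On-left t = FX.On-symmetric (On-right t)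

On-up : ∀ t → On t (+0 , + t) up
On-up t = subst (λ p → On t p up) (ray-up t) (On-ray up t)

On-zero : ∀ {t p d} → On t p d → t ≡ 0 → p ≡ origin
On-zero seed _ = refl
On-zero (even {zero} D) _ = cong dbl (On-zero D refl)

On-unique : ∀ {s t p d e} → On s p d → On t p e → p ≢ origin → s ≡ t × d ≡ e
On-unique D E p≢ with uniqueTime D E refl
On-unique {zero}  D E p≢ | refl = contradiction (On-zero D refl) p≢
On-unique {suc s} D E p≢ | refl = refl , uniqueDir D E

-- T-toothpicks as cells of shifted automata.

-- The T-toothpicks: the first one has no upward arm, so the half plane y ≤ 0 sees the
-- automaton centred at the origin, while each quadrant x ≠ 0, y > 0 sees the one centred at
-- (±1 , 0) and delayed by one stage; on x = 0, y > 0 the two mirror images collide.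
Cell : ℕ → Pt → Dir → Set
Cell t       (x , -[1+ y ])          d = On t (x , -[1+ y ]) d
Cell t       (x , +0)                d = On t (x , +0) d × (t ≡ 0 → d ≡ down)
Cell t       (+0 , +[1+ y ])         d = ⊥
Cell zero    (+[1+ x ] , +[1+ y ])   d = ⊥
Cell zero    (-[1+ x ] , +[1+ y ])   d = ⊥
Cell (suc t) (+[1+ x ] , +[1+ y ])   d = On t (+ x , +[1+ y ]) d
Cell (suc t) (-[1+ x ] , +[1+ y ])   d = On t (+ x , +[1+ y ]) (mirror d)

Cell-mirror : ∀ t p d → Cell t p d → Cell t (FX.pt p) (mirror d)
Cell-mirror t       (x , -[1+ y ])          d C = FX.On-symmetric C
Cell-mirror t       (x , +0)                d (C , h) = FX.On-symmetric C , (λ t≡0 → cong mirror (h t≡0))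
Cell-mirror (suc t) (+[1+ x ] , +[1+ y ])   d C = subst (On t _) (sym (FX.dir-inv d)) C
Cell-mirror (suc t) (-[1+ x ] , +[1+ y ])   d C = C

cell-unique : ∀ {s t} p {d e} → Cell s p d → Cell t p e → s ≡ t × d ≡ e
cell-unique (x , -[1+ y ]) C D = On-unique C D (λ ())
cell-unique (+0 , +0) (C , h) (D , k) with uniqueTime C (seed {down}) refl | uniqueTime D (seed {down}) refl
... | refl | refl = refl , trans (h refl) (sym (k refl))
cell-unique (+[1+ x ] , +0) (C , _) (D , _) = On-unique C D (λ ())
cell-unique (-[1+ x ] , +0) (C , _) (D , _) = On-unique C D (λ ())
cell-unique {suc s} {suc t} (+[1+ x ] , +[1+ y ]) C D with On-unique C D (λ ())
... | refl , d≡e = refl , d≡e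
cell-unique {suc s} {suc t} (-[1+ x ] , +[1+ y ]) C D with On-unique C D (λ ())
... | refl , d≡e = refl , FX.dir-injective d≡e

-- Neighbouring T-toothpicks.

shift : Pt → Pt
shift (x , y) = (ℤ.pred x , y)

unshift : Pt → Pt
unshift (x , y) = (ℤ.suc x , y)

shift-step : ∀ p d → shift (p ⊕ vec d) ≡ shift p ⊕ vec d
shift-step (a , b) d = cong (_, b ℤ.+ proj₂ (vec d)) (sym (ℤP.+-assoc ℤ.-1ℤ a (proj₁ (vec d))))

unshift-step : ∀ p d → unshift (p ⊕ vec d) ≡ unshift p ⊕ vec d
unshift-step (a , b) d = cong (_, b ℤ.+ proj₂ (vec d)) (sym (ℤP.+-assoc 1ℤ a (proj₁ (vec d))))

shift-unshift : ∀ p → shift (unshift p) ≡ p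
shift-unshift (a , b) = cong (_, b) (ℤP.pred-suc a)

-- The chart of the upper right quadrant extends to the row `y = 0`: there the cell born at time
-- `suc x` from the left corresponds to the chart cell at `x`, one time unit earlier and with the
-- same direction.
right-chart : ∀ {t} x y {d} → Cell t (+[1+ x ] , + y) d →
              ∃ λ s → t ≡ suc s × On s (+ x , + y) d
right-chart x zero (C , _) with On-unique C (On-right (suc x)) (λ ())
... | refl , refl = x , refl , On-right x
right-chart {suc t} x (suc y) C = t , refl , C

step-pos : ∀ {y} j d → +[1+ y ] ≡ j ℤ.+ proj₂ (vec d) → ∃ λ k → j ≡ + k
step-pos (+ k) d eq = k , refl
step-pos -[1+ zero ] up ()
step-pos -[1+ suc k ] up ()
step-pos -[1+ k ] down ()
step-pos -[1+ k ] left ()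
step-pos -[1+ k ] right ()

step-posˣ : ∀ {x} j d → +[1+ x ] ≡ j ℤ.+ proj₁ (vec d) → ∃ λ k → j ≡ + k
step-posˣ (+ k) d eq = k , refl
step-posˣ -[1+ zero ] right ()
step-posˣ -[1+ suc k ] right ()
step-posˣ -[1+ k ] down ()
step-posˣ -[1+ k ] left ()
step-posˣ -[1+ k ] up ()

vec-axis : ∀ {x y} d → (+[1+ x ] , +[1+ y ]) ≢ origin ⊕ vec d
vec-axis up ()
vec-axis down ()
vec-axis left ()
vec-axis right ()

-- A neighbour outside the chart would have `x = 0`; above the origin that line carries no cells,
-- and the origin has no neighbour in the open quadrant.
right-neighbour : ∀ {t x y} q {e} f → Cell t q e → (+[1+ x ] , +[1+ y ]) ≡ q ⊕ vec f →
                  ∃₂ λ a b → q ≡ (+[1+ a ] , + b)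
right-neighbour (i , j) f C eq with step-posˣ i f (cong proj₁ eq) | step-pos j f (cong proj₂ eq)
... | suc a , refl | b , refl = a , b , refl
right-neighbour _ f C eq | zero , refl | zero , refl = ⊥-elim (vec-axis f eq)
right-neighbour _ f () eq | zero , refl | suc b , refl

right-adjacent : ∀ {s t x y d e} q f → Cell s (+[1+ x ] , +[1+ y ]) d → Cell t q e →
                 (+[1+ x ] , +[1+ y ]) ≡ q ⊕ vec f → Adjacent s d t e f
right-adjacent {suc s} {x = x} {y} q f C D eq with right-neighbour q f D eq
... | a , b , refl with right-chart a b D
...   | t , refl , D′ with adjacent f C D′ (trans (cong shift eq) (shift-step q f))
...     | inj₁ (t<s , h) = inj₁ (s≤s t<s , h)
...     | inj₂ (s<t , h) = inj₂ (s≤s s<t , h)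

Adjacent-mirror : ∀ {s d t e f} → Adjacent s (mirror d) t (mirror e) (mirror f) → Adjacent s d t e f
Adjacent-mirror (inj₁ (t<s , h)) = inj₁ (t<s , FX.dir-injective h)
Adjacent-mirror {f = f} (inj₂ (s<t , h)) = inj₂ (s<t , FX.dir-injective (trans (FX.dir-opp f) h))

Adjacent-sym : ∀ {s d t e f} → Adjacent t e s d (opp f) → Adjacent s d t e f
Adjacent-sym {f = f} (inj₁ h) = inj₂ h
Adjacent-sym {f = f} (inj₂ (t<s , h)) = inj₁ (t<s , trans (sym (opp-involutive f)) h)

upper-adjacent : ∀ {s t y d e} x q f → Cell s (x , +[1+ y ]) d → Cell t q e →
                 (x , +[1+ y ]) ≡ q ⊕ vec f → Adjacent s d t e f
upper-adjacent +0 q f () D eq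
upper-adjacent +[1+ x ] q f C D eq = right-adjacent q f C D eq
upper-adjacent {s} {t} {y} {d} {e} -[1+ x ] q f C D eq = Adjacent-mirror (right-adjacent (FX.pt q) (mirror f)
  (Cell-mirror s (-[1+ x ] , +[1+ y ]) d C) (Cell-mirror t q e D) (trans (cong FX.pt eq) (FX.pt-step q f)))

Lower : Pt → Set
Lower (_ , -[1+ _ ]) = ⊤
Lower (_ , +0)       = ⊤
Lower (_ , +[1+ _ ]) = ⊥

cell⇒on : ∀ {t} p {d} → Lower p → Cell t p d → On t p d
cell⇒on (_ , -[1+ _ ]) _ C = C
cell⇒on (_ , +0)       _ C = proj₁ C

cell-adjacent : ∀ {s t d e} p q f → Cell s p d → Cell t q e → p ≡ q ⊕ vec f → Adjacent s d t e f
cell-adjacent (x , +[1+ y ]) q f C D eq = upper-adjacent x q f C D eq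
cell-adjacent p (x , +[1+ y ]) f C D eq =
  Adjacent-sym (upper-adjacent x p (opp f) D C (step-move p (x , +[1+ y ]) f eq))
cell-adjacent p@(_ , +0)       q@(_ , +0)       f C D eq = adjacent f (cell⇒on p tt C) (cell⇒on q tt D) eq
cell-adjacent p@(_ , +0)       q@(_ , -[1+ _ ]) f C D eq = adjacent f (cell⇒on p tt C) (cell⇒on q tt D) eq
cell-adjacent p@(_ , -[1+ _ ]) q@(_ , +0)       f C D eq = adjacent f (cell⇒on p tt C) (cell⇒on q tt D) eq
cell-adjacent p@(_ , -[1+ _ ]) q@(_ , -[1+ _ ]) f C D eq = adjacent f (cell⇒on p tt C) (cell⇒on q tt D) eq

-- Parents of T-toothpicks.

lower-cell : ∀ {t} q {d} → Lower q → On t q d → ∃ λ e → Cell t q e × (e ≡ d ⊎ (q ≡ origin × e ≡ down))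
lower-cell (x , -[1+ y ]) {d} _ D = d , D , inj₁ refl
lower-cell {zero} (x , +0) _ D with On-zero D refl
... | refl = down , (seed , λ _ → refl) , inj₂ (refl , refl)
lower-cell {suc t} (x , +0) {d} _ D = d , (D , λ ()) , inj₁ refl

-- The direction may change only on the row `b = 0`: the origin of the chart is a seed with every
-- direction, whereas the T-toothpick there points right.
right-cell : ∀ {t} a b {d} → On t (+ a , + b) d →
             ∃ λ e → Cell (suc t) (+[1+ a ] , + b) e × (e ≡ d ⊎ (b ≡ 0 × e ≡ right))
right-cell a zero D with uniqueTime D (On-right a) refl
... | refl = right , (On-right (suc a) , λ ()) , inj₂ (refl , refl)
right-cell a (suc b) {d} D = d , D , inj₁ refl

lower-step : ∀ {y} i j d → -[1+ y ] ≡ j ℤ.+ proj₂ (vec d) → Lower (i , j)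
lower-step i +0       d eq = tt
lower-step i -[1+ _ ] d eq = tt
lower-step i +[1+ k ] up ()
lower-step i +[1+ k ] down ()
lower-step i +[1+ k ] left ()
lower-step i +[1+ k ] right ()

down-step : ∀ {x y} d → (x , -[1+ y ]) ≡ origin ⊕ vec d → d ≡ down
down-step down _ = refl
down-step up ()
down-step left ()
down-step right ()

up-step : ∀ {y} d → +[1+ y ] ≡ +0 ℤ.+ proj₂ (vec d) → d ≡ up
up-step up _ = refl
up-step down ()
up-step left ()
up-step right ()

step-nonneg : ∀ {x} i d → + x ≡ i ℤ.+ proj₁ (vec d) → (∃ λ a → i ≡ + a) ⊎ (x ≡ 0 × d ≡ right)
step-nonneg (+ a) d eq = inj₁ (a , refl)
step-nonneg -[1+ zero ] right eq = inj₂ (ℤP.+-injective eq , refl)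
step-nonneg -[1+ suc k ] right ()
step-nonneg -[1+ k ] down ()
step-nonneg -[1+ k ] left ()
step-nonneg -[1+ k ] up ()

Parent : ℕ → Pt → Dir → Set
Parent t p d = ∃₂ λ q e → Cell t q e × d ≢ opp e × p ≡ q ⊕ vec d

Parent-mirror : ∀ t p d → Parent t (FX.pt p) (mirror d) → Parent t p d
Parent-mirror t p d (q , e , C , turn , eq) =
  FX.pt q , mirror e , Cell-mirror t q e C ,
  (λ h → turn (trans (cong mirror h) (trans (FX.dir-opp (mirror e)) (cong opp (FX.dir-inv e))))) ,
  FX.pt-injective (trans eq (sym (trans (FX.pt-step (FX.pt q) d) (cong (_⊕ vec (mirror d)) (FX.pt-inv q)))))

right-axis-parent : ∀ t x d → Cell (suc t) (+[1+ x ] , +0) d → Parent t (+[1+ x ] , +0) d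
right-axis-parent t x d (C , _) with On-unique C (On-right (suc x)) (λ ())
right-axis-parent zero    _ _ _ | refl , refl = origin , down , (seed , λ _ → refl) , (λ ()) , refl
right-axis-parent (suc t) _ _ _ | refl , refl =
  (+[1+ t ] , +0) , right , (On-right (suc t) , λ ()) , (λ ()) , cong (λ k → + k , +0) (ℕP.+-comm 1 (suc t))

right-parent : ∀ t x y d → On t (+ x , +[1+ y ]) d → Parent t (+[1+ x ] , +[1+ y ]) d
right-parent zero x y d C with () ← On-zero C refl
right-parent (suc t) x y d C with parent C t refl
... | (i , j) , d′ , D , turn , eq with step-pos j d (cong proj₂ eq) | step-nonneg i d (cong proj₁ eq)
-- A chart parent left of the chart would enter its vertical axis sideways, but the cells of that
-- axis point up.
...   | b , refl | inj₂ (refl , refl) with () ← proj₂ (On-unique C (On-up (suc y)) (λ ()))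
...   | b , refl | inj₁ (a , refl) with right-cell a b D
...     | e , E , e≡ = (+[1+ a ] , + b) , e , E , turn′ e≡ ,
                       trans (cong unshift eq) (unshift-step (+ a , + b) d)
  where
  turn′ : e ≡ d′ ⊎ (b ≡ 0 × e ≡ right) → d ≢ opp e
  turn′ (inj₁ refl) = turn
  turn′ (inj₂ (refl , refl)) with up-step d (cong proj₂ eq)
  ... | refl = λ ()

cell-parent : ∀ t p d → Cell (suc t) p d → Parent t p d
cell-parent t (x , -[1+ y ]) d C with parent C t refl
... | (i , j) , d′ , D , turn , eq with lower-cell (i , j) (lower-step i j d (cong proj₂ eq)) D
...   | _ , E , inj₁ refl = (i , j) , d′ , E , turn , eq
...   | _ , E , inj₂ (refl , refl) with down-step d eq
...     | refl = origin , down , E , (λ ()) , eq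
cell-parent t (+0 , +0) d (C , _) with () ← uniqueTime C (seed {d}) refl
cell-parent t (+[1+ x ] , +0) d C = right-axis-parent t x d C
cell-parent t p@(-[1+ x ] , +0) d C =
  Parent-mirror t p d (right-axis-parent t x (mirror d) (Cell-mirror (suc t) p d C))
cell-parent t (+[1+ x ] , +[1+ y ]) d C = right-parent t x y d C
cell-parent t p@(-[1+ x ] , +[1+ y ]) d C = Parent-mirror t p d (right-parent t x y (mirror d) C)

-- Growth of T-toothpicks: a new cell or a blocked endpoint.

Grows : ℕ → Pt → Pt → Dir → Set
Grows s c p d = Cell (suc s) p d ⊎ Blocked Cell s c p

-- If the endpoint carries a cell of any time at all, `cell-adjacent` puts its parent at the
-- midpoint of `c`, since the reverse relation contradicts the forward step. The time of that parent
-- is unique, which fixes the time of the cell.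
grow-onto-cell : ∀ {s u d′ e} c p d → Cell s c d′ → d ≢ opp d′ → Cell u p e → p ≡ c ⊕ vec d → Cell (suc s) p d
grow-onto-cell {u = u} c p d C turn D eq with cell-adjacent p c d D C eq
... | inj₂ (_ , h) = contradiction (opp-flip (sym h)) turn
grow-onto-cell {u = suc u} c p d C turn D eq | inj₁ (_ , refl) with cell-parent u p d D
... | q , e , E , _ , eq′ with step-cancelʳ c q d (trans (sym eq) eq′)
...   | refl with cell-unique q C E
...     | refl , _ = D

Blocked-mirror : ∀ s c p → Blocked Cell s (FX.pt c) (FX.pt p) → Blocked Cell s c p
Blocked-mirror s c p (t , q , e , t≤ , C , q≢ , touch) =
  t , FX.pt q , mirror e , t≤ , Cell-mirror t q e C ,
  (λ h → q≢ (trans (sym (FX.pt-inv q)) (cong FX.pt h))) , touches-mirror touch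
  where
  touches-mirror : Touch q e (FX.pt p) → Touch (FX.pt q) (mirror e) p
  touches-mirror (inj₁ h) = inj₁ (trans (cong FX.pt h) (FX.pt-inv p))
  touches-mirror (inj₂ (f , f≢ , h)) = inj₂ (mirror f , FX.dir-≢opp f≢ ,
    trans (sym (FX.pt-step q f)) (trans (cong FX.pt h) (FX.pt-inv p)))

-- A point of the line `x = 0` is its own mirror image, so the mirror image of `c` touches it too.
mirror-blocks : ∀ s c {y d′} d → FX.pt c ≢ c → Cell s c d′ → d ≢ opp d′ →
                (+0 , y) ≡ c ⊕ vec d → Blocked Cell s c (+0 , y)
mirror-blocks s c {d′ = d′} d c≢ C turn eq =
  s , FX.pt c , mirror d′ , ℕP.≤-refl , Cell-mirror s c d′ C , c≢ ,
  inj₂ (mirror d , FX.dir-≢opp turn , trans (sym (FX.pt-step c d)) (cong FX.pt (sym eq)))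

grow-centre : ∀ {s y d′} c d → Cell s c d′ → d ≢ opp d′ →
              (+0 , +[1+ y ]) ≡ c ⊕ vec d → Blocked Cell s c (+0 , +[1+ y ])
grow-centre {s} c@(+[1+ x ] , j) d C turn eq = mirror-blocks s c d (λ ()) C turn eq
grow-centre {s} c@(-[1+ x ] , j) d C turn eq = mirror-blocks s c d (λ ()) C turn eq
grow-centre (+0 , j) d C turn eq with step-pos j d (cong proj₂ eq)
grow-centre (+0 , j) d (C , h) turn eq | zero , refl with uniqueTime C (seed {d}) refl
... | refl with h refl | up-step d (cong proj₂ eq)
...   | refl | refl = contradiction refl turn
grow-centre (+0 , j) d () turn eq | suc k , refl

-- The column next to the axis is filled by the chart's upward ray, so `grow-onto-cell` applies. It
-- is treated apart because a blocker supplied by `grow-On` might there lie left of the chart and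
-- have no T-toothpick; further right every blocker has nonnegative chart coordinates.
grow-right : ∀ {s x y d′} c d → Cell s c d′ → d ≢ opp d′ →
             (+[1+ x ] , +[1+ y ]) ≡ c ⊕ vec d → Grows s c (+[1+ x ] , +[1+ y ]) d
grow-right {x = zero} {y} c d C turn eq =
  inj₁ (grow-onto-cell {u = suc (suc y)} c (+[1+ 0 ] , +[1+ y ]) d C turn (On-up (suc y)) eq)
grow-right {x = suc x} {y} c d C turn eq with right-neighbour c d C eq
... | a , b , refl with right-chart a b C
...   | s , refl , D with grow-On d D turn
...     | inj₁ E = inj₁ (subst (λ p → On (suc s) p d) (sym (trans (cong shift eq) (shift-step c d))) E)
...     | inj₂ (t , q , e , t≤ , E , q≢ , touch) = inj₂ (near q E q≢ (subst (Touch q e) (sym (trans (cong shift eq) (shift-step c d))) touch))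
  where
  near : ∀ q → On t q e → q ≢ (+ a , + b) → Touch q e (+[1+ x ] , +[1+ y ]) →
         Blocked Cell (suc s) c (+[1+ suc x ] , +[1+ y ])
  near _ E q≢ (inj₁ refl) =
    suc t , (+[1+ suc x ] , +[1+ y ]) , e , s≤s t≤ , E , (λ h → q≢ (cong shift h)) , inj₁ refl
  near (i , j) E q≢ (inj₂ (f , f≢ , h)) with step-posˣ i f (sym (cong proj₁ h)) | step-pos j f (sym (cong proj₂ h))
  ... | k , refl | l , refl with right-cell k l E
  ...   | e′ , E′ , e≡ = suc t , (+[1+ k ] , + l) , e′ , s≤s t≤ , E′ , (λ g → q≢ (cong shift g)) ,
                         inj₂ (f , turn′ e≡ , trans (sym (unshift-step (+ k , + l) f)) (cong unshift h))
    where
    turn′ : e′ ≡ e ⊎ (l ≡ 0 × e′ ≡ right) → f ≢ opp e′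
    turn′ (inj₁ refl) = f≢
    turn′ (inj₂ (refl , refl)) with up-step f (sym (cong proj₂ h))
    ... | refl = λ ()

grow-lower : ∀ {s x y d′} c d → Cell s c d′ → d ≢ opp d′ →
             (x , -[1+ y ]) ≡ c ⊕ vec d → Grows s c (x , -[1+ y ]) d
grow-lower {s} {x} {y} (i , j) d C turn eq with grow-On d (cell⇒on (i , j) (lower-step i j d (cong proj₂ eq)) C) turn
... | inj₁ E = inj₁ (subst (λ p → On (suc s) p d) (sym eq) E)
... | inj₂ (t , q , e , t≤ , E , q≢ , touch) = inj₂ (near (subst (Touch q e) (sym eq) touch))
  where
  near : Touch q e (x , -[1+ y ]) → Blocked Cell s (i , j) (x , -[1+ y ])
  near (inj₁ refl) = t , _ , e , t≤ , E , q≢ , inj₁ refl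
  near (inj₂ (f , f≢ , h)) with lower-cell q (lower-step (proj₁ q) (proj₂ q) f (sym (cong proj₂ h))) E
  ... | _ , E′ , inj₁ refl = t , q , e , t≤ , E′ , q≢ , inj₂ (f , f≢ , h)
  ... | _ , E′ , inj₂ (refl , refl) with down-step f (sym h)
  ...   | refl = t , q , down , t≤ , E′ , q≢ , inj₂ (down , (λ ()) , h)

cell-grow : ∀ {s d′} c p d → Cell s c d′ → d ≢ opp d′ → p ≡ c ⊕ vec d → Grows s c p d
cell-grow c (x , -[1+ y ]) d C turn eq = grow-lower c d C turn eq
cell-grow c (+0 , +0) d C turn eq =
  inj₁ (grow-onto-cell {u = 0} {e = down} c (+0 , +0) d C turn (seed , λ _ → refl) eq)
cell-grow c (+[1+ x ] , +0) d C turn eq =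
  inj₁ (grow-onto-cell {u = suc x} c (+[1+ x ] , +0) d C turn (On-right (suc x) , λ ()) eq)
cell-grow c (-[1+ x ] , +0) d C turn eq =
  inj₁ (grow-onto-cell {u = suc x} c (-[1+ x ] , +0) d C turn (On-left (suc x) , λ ()) eq)
cell-grow c (+0 , +[1+ y ]) d C turn eq = inj₂ (grow-centre c d C turn eq)
cell-grow c (+[1+ x ] , +[1+ y ]) d C turn eq = grow-right c d C turn eq
cell-grow {s} {d′} c p@(-[1+ x ] , +[1+ y ]) d C turn eq
  with grow-right (FX.pt c) (mirror d) (Cell-mirror s c d′ C) (FX.dir-≢opp turn)
         (trans (cong FX.pt eq) (FX.pt-step c d))
... | inj₁ E = inj₁ E
... | inj₂ B = inj₂ (Blocked-mirror s c p B)

-- Exposed endpoints as list members.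

module _ {A : Set} where

  any-sound : ∀ (f : A → Bool) xs → any f xs ≡ true → ∃ λ x → x ∈ xs × f x ≡ true
  any-sound f xs eq with find (any⁻ f xs (Equivalence.from T-≡ eq))
  ... | x , x∈ , fx = x , x∈ , Equivalence.to T-≡ fx

  any-complete : ∀ (f : A → Bool) {x xs} → x ∈ xs → f x ≡ true → any f xs ≡ true
  any-complete f x∈ eq = Equivalence.to T-≡ (any⁺ f (lose x∈ (Equivalence.from T-≡ eq)))

  unique-middle : ∀ pre {post} {s t : A} → Unique (pre ++ t ∷ post) → s ∈ pre ++ post → s ≢ t
  unique-middle []        (t≢ ∷ _)  s∈         refl = lookup t≢ s∈ refl
  unique-middle (x ∷ pre) (x≢ ∷ _)  (here refl) = lookup x≢ (∈-++⁺ʳ pre (here refl))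
  unique-middle (x ∷ pre) (_ ∷ u)   (there s∈)  = unique-middle pre u s∈

  ∈-middle⁻ : ∀ pre {post} {s t : A} → s ∈ pre ++ t ∷ post → s ≢ t → s ∈ pre ++ post
  ∈-middle⁻ []        (here refl)  s≢ = contradiction refl s≢
  ∈-middle⁻ []        (there s∈)   s≢ = s∈
  ∈-middle⁻ (x ∷ pre) (here refl)  s≢ = here refl
  ∈-middle⁻ (x ∷ pre) (there s∈)   s≢ = there (∈-middle⁻ pre s∈ s≢)

  ∈-middle⁺ : ∀ pre {post} {s t : A} → s ∈ pre ++ post → s ∈ pre ++ t ∷ post
  ∈-middle⁺ pre s∈ with ∈-++⁻ pre s∈
  ... | inj₁ h = ∈-++⁺ˡ h
  ... | inj₂ h = ∈-++⁺ʳ pre (there h)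

ends-sound : ∀ c {p d} → (p , d) ∈ ends c → d ≢ opp (stem c) × p ≡ mid c ⊕ vec d
ends-sound (mkTT p d) (here refl)                 = d≢opp-d d , refl
ends-sound (mkTT p d) (there (here refl))         = rotL≢opp d , refl
ends-sound (mkTT p d) (there (there (here refl))) = rotR≢opp d , refl

ends-complete : ∀ c {d} → d ≢ opp (stem c) → (mid c ⊕ vec d , d) ∈ ends c
ends-complete (mkTT p e) {d} turn with compare e d
... | same     = here refl
... | opposite = contradiction refl turn
... | turnL    = there (here refl)
... | turnR    = there (there (here refl))

ends-unique : ∀ c → Unique (ends c)
ends-unique (mkTT p d) =
  ((λ eq → rotL≢ d (sym (cong proj₂ eq))) ∷ (λ eq → rotR≢ d (sym (cong proj₂ eq))) ∷ []) ∷
  ((λ eq → rotL≢rotR d (cong proj₂ eq)) ∷ []) ∷ [] ∷ []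

ends-in : Pt → Pt × Dir → Bool
ends-in p e = does (proj₁ e ≟ₚ p)

touches-sound : ∀ c p → touches c p ≡ true → Touch (mid c) (stem c) p
touches-sound c p eq with mid c ≟ₚ p
... | yes h = inj₁ h
... | no _ with any-sound (ends-in p) (ends c) eq
...   | (q , d) , e∈ , h with q ≟ₚ p
...     | no _ with () ← h
...     | yes refl with ends-sound c e∈
...       | turn , q≡ = inj₂ (d , turn , sym q≡)

touches-complete : ∀ c p → Touch (mid c) (stem c) p → touches c p ≡ true
touches-complete c p touch with mid c ≟ₚ p | touch
... | yes _ | _ = refl
... | no ≢p | inj₁ h = contradiction h ≢p
... | no _  | inj₂ (d , turn , refl) = any-complete (ends-in p) (ends-complete c turn) (dec-true (_ ≟ₚ p) refl)

Untouched : List TT → Pt × Dir → Set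
Untouched S e = any (λ s → touches s (proj₁ e)) S ≢ true

untouched? : ∀ S e → Dec (Untouched S e)
untouched? S e = ¬? (any (λ s → touches s (proj₁ e)) S Bool.≟ true)

-- `exposedAux` leaves out one position of the list, this predicate leaves out one value; for lists
-- without repetition the two agree.
Exposed : List TT → TT → Pt × Dir → Set
Exposed S c e = e ∈ ends c × (∀ s → s ∈ S → s ≢ c → touches s (proj₁ e) ≢ true)

∈-exposedAux⁻ : ∀ pre post {e} → e ∈ exposedAux pre post → ∃ λ c → c ∈ post × Exposed (pre ++ post) c e
∈-exposedAux⁻ pre (c ∷ post) {e} e∈ with ∈-++⁻ (exposedOf (pre ++ post) c) e∈
... | inj₁ h with ∈-filter⁻ (untouched? (pre ++ post)) {xs = ends c} h
...   | e∈c , free = c , here refl , e∈c ,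
  λ s s∈ s≢ touch → free (any-complete (λ s → touches s (proj₁ e)) (∈-middle⁻ pre s∈ s≢) touch)
∈-exposedAux⁻ pre (c ∷ post) {e} e∈ | inj₂ h with ∈-exposedAux⁻ (pre ++ c ∷ []) post h
... | c′ , c′∈ , exp = c′ , there c′∈ , subst (λ S → Exposed S c′ e) (ListP.++-assoc pre (c ∷ []) post) exp

∈-exposedAux⁺ : ∀ pre post {c e} → Unique (pre ++ post) → c ∈ post → Exposed (pre ++ post) c e →
                e ∈ exposedAux pre post
∈-exposedAux⁺ pre (c ∷ post) {e = e} u (here refl) (e∈ , free) = ∈-++⁺ˡ (∈-filter⁺ (untouched? (pre ++ post)) e∈ untouched)
  where
  untouched : Untouched (pre ++ post) e
  untouched eq with any-sound (λ s → touches s (proj₁ e)) (pre ++ post) eq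
  ... | s , s∈ , touch = free s (∈-middle⁺ pre s∈) (unique-middle pre u s∈) touch
∈-exposedAux⁺ pre (c ∷ post) {c′} {e} u (there c∈) exp = ∈-++⁺ʳ (exposedOf (pre ++ post) c)
  (∈-exposedAux⁺ (pre ++ c ∷ []) post (subst Unique assoc u) c∈ (subst (λ S → Exposed S c′ e) assoc exp))
  where
  assoc : pre ++ c ∷ post ≡ (pre ++ c ∷ []) ++ post
  assoc = sym (ListP.++-assoc pre (c ∷ []) post)

-- An endpoint listed for two different T-toothpicks is touched by each of them, hence exposed for
-- neither.
exposedAux-unique : ∀ pre post → Unique (pre ++ post) → Unique (exposedAux pre post)
exposedAux-unique pre [] u = []
exposedAux-unique pre (c ∷ post) u = UniqueP.++⁺ (UniqueP.filter⁺ (untouched? (pre ++ post)) (ends-unique c))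
  (exposedAux-unique (pre ++ c ∷ []) post (subst Unique assoc u)) disjoint
  where
  assoc : pre ++ c ∷ post ≡ (pre ++ c ∷ []) ++ post
  assoc = sym (ListP.++-assoc pre (c ∷ []) post)
  disjoint : ∀ {e} → ¬ (e ∈ exposedOf (pre ++ post) c × e ∈ exposedAux (pre ++ c ∷ []) post)
  disjoint (h , k) with ∈-filter⁻ (untouched? (pre ++ post)) {xs = ends c} h | ∈-exposedAux⁻ (pre ++ c ∷ []) post k
  ... | e∈ , _ | c′ , c′∈ , _ , free with ends-sound c e∈
  ...   | turn , p≡ = free c (∈-++⁺ˡ (∈-++⁺ʳ pre (here refl)))
    (λ eq → unique-middle pre u (∈-++⁺ʳ pre c′∈) (sym eq))
    (touches-complete c _ (inj₂ (_ , turn , sym p≡)))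

-- The structure enumerates the cells.

record Enumerates {A : Set} (xs : List A) (P : A → Set) : Set where
  field
    unique   : Unique xs
    sound    : ∀ {a} → a ∈ xs → P a
    complete : ∀ {a} → P a → a ∈ xs
open Enumerates

At : ℕ → TT → Set
At t c = Cell t (mid c) (stem c)

UpTo : ℕ → TT → Set
UpTo m c = ∃ λ t → t ≤ m × At t c

grow-enumerates : ∀ {S m} → Enumerates S (UpTo m) → Enumerates (grow S) (At (suc m))
grow-enumerates {S} {m} En = record
  { unique = UniqueP.map⁺ (λ { refl → refl }) (exposedAux-unique [] S (unique En))
  ; sound = snd
  ; complete = cmp
  }
  where
  snd : ∀ {c} → c ∈ grow S → At (suc m) c
  snd c∈ with ∈-map⁻ _ c∈
  ... | (p , d) , e∈ , refl with ∈-exposedAux⁻ [] S e∈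
  ...   | c , c∈S , e∈c , free with ends-sound c e∈c | sound En c∈S
  ...     | turn , p≡ | s , s≤m , C with cell-grow (mid c) p d C turn p≡
  ...       | inj₂ (t , q , e , t≤ , D , q≢ , touch) =
    contradiction (touches-complete (mkTT q e) p touch)
      (free (mkTT q e) (complete En (t , ℕP.≤-trans t≤ s≤m , D)) (λ eq → q≢ (cong mid eq)))
  ...       | inj₁ D with ℕP.m≤n⇒m<n∨m≡n s≤m
  ...         | inj₂ refl = D
  -- Growth from an older generation has already happened: the cell is in `S`, and its own midpoint
  -- touches the endpoint.
  ...         | inj₁ s<m = contradiction (touches-complete (mkTT p d) p (inj₁ refl))
    (free (mkTT p d) (complete En (suc s , s<m , D))
      (λ eq → step-≢ (mid c) d (trans (sym p≡) (cong mid eq))))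
  cmp : ∀ {c} → At (suc m) c → c ∈ grow S
  cmp {mkTT p d} C with cell-parent m p d C
  ... | q , e , D , turn , refl = ∈-map⁺ _ (∈-exposedAux⁺ [] S (unique En)
          (complete En {mkTT q e} (m , ℕP.≤-refl , D)) (ends-complete (mkTT q e) turn , free))
    where
    free : ∀ s → s ∈ S → s ≢ mkTT q e → touches s p ≢ true
    free (mkTT r f) s∈ s≢ eq with sound En s∈ | touches-sound (mkTT r f) p eq
    ... | t , t≤m , E | inj₁ refl with cell-unique p C E
    ...   | refl , _ = ℕP.1+n≰n t≤m
    free (mkTT r f) s∈ s≢ eq | t , t≤m , E | inj₂ (g , g≢ , r≡) with cell-adjacent p r g C E (sym r≡)
    ... | inj₂ (_ , h) = g≢ (opp-flip (sym h))
    ... | inj₁ (_ , refl) with step-cancelʳ r q d r≡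
    ...   | refl with cell-unique r D E
    ...     | _ , refl = s≢ refl

cell-zero : ∀ p {d} → Cell 0 p d → mkTT p d ≡ initial
cell-zero (x , -[1+ y ]) C with () ← On-zero C refl
cell-zero (x , +0) (C , h) with On-zero C refl | h refl
... | refl | refl = refl
cell-zero (+0 , +[1+ y ]) ()
cell-zero (+[1+ x ] , +[1+ y ]) ()
cell-zero (-[1+ x ] , +[1+ y ]) ()

structure-enumerates : ∀ m → Enumerates (structure (suc m)) (UpTo m)
structure-enumerates zero = record
  { unique = [] ∷ []
  ; sound = λ { (here refl) → 0 , z≤n , seed , λ _ → refl }
  ; complete = λ { (zero , _ , C) → here (cell-zero _ C) }
  }
structure-enumerates (suc m) = record
  { unique = UniqueP.++⁺ (unique old) (unique new) (λ { (h , k) → disjoint h k })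
  ; sound = snd
  ; complete = cmp
  }
  where
  old = structure-enumerates m
  new = grow-enumerates old
  disjoint : ∀ {c} → c ∈ structure (suc m) → c ∈ grow (structure (suc m)) → ⊥
  disjoint {c} h k with sound old h
  ... | t , t≤m , C with cell-unique (mid c) C (sound new k)
  ...   | refl , _ = ℕP.1+n≰n t≤m
  snd : ∀ {c} → c ∈ structure (suc (suc m)) → UpTo (suc m) c
  snd c∈ with ∈-++⁻ (structure (suc m)) c∈
  ... | inj₁ h with sound old h
  ...   | t , t≤m , C = t , ℕP.m≤n⇒m≤1+n t≤m , C
  snd c∈ | inj₂ k = suc m , ℕP.≤-refl , sound new k
  cmp : ∀ {c} → UpTo (suc m) c → c ∈ structure (suc (suc m))
  cmp (t , t≤ , C) with ℕP.m≤n⇒m<n∨m≡n t≤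
  ... | inj₁ (s≤s t≤m) = ∈-++⁺ˡ (complete old (t , t≤m , C))
  ... | inj₂ refl = ∈-++⁺ʳ (structure (suc m)) (complete new C)

-- Counting by bijections.

Count : {A : Set} → (A → Set) → ℕ → Set
Count {A} P n = ∃ λ (xs : List A) → Enumerates xs P × length xs ≡ n

module _ {A : Set} where

  enumerations-equinumerous : ∀ {P : A → Set} {xs ys} → Enumerates xs P → Enumerates ys P → length xs ≡ length ys
  enumerations-equinumerous E F = ↭-length (∼bag⇒↭ (unique∧set⇒bag (unique E) (unique F)
    (mk⇔ (complete F ∘ sound E) (complete E ∘ sound F))))

  count-one : ∀ (a : A) → Count (_≡ a) 1
  count-one a = a ∷ [] , record
    { unique = [] ∷ [] ; sound = λ { (here eq) → eq } ; complete = here } , refl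

  count-cong : ∀ {P Q : A → Set} {n} → (∀ {a} → P a → Q a) → (∀ {a} → Q a → P a) → Count P n → Count Q n
  count-cong to from (xs , E , len) = xs , record
    { unique = unique E ; sound = to ∘ sound E ; complete = complete E ∘ from } , len

  count-⊎ : ∀ {P Q : A → Set} {m n} → (∀ {a} → P a → Q a → ⊥) → Count P m → Count Q n →
            Count (λ a → P a ⊎ Q a) (m + n)
  count-⊎ disjoint (xs , E , refl) (ys , F , refl) = xs ++ ys , record
    { unique   = UniqueP.++⁺ (unique E) (unique F) (λ { (h , k) → disjoint (sound E h) (sound F k) })
    ; sound    = snd
    ; complete = λ { (inj₁ h) → ∈-++⁺ˡ (complete E h) ; (inj₂ k) → ∈-++⁺ʳ xs (complete F k) }
    } , ListP.length-++ xs
    where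
    snd : ∀ {a} → a ∈ xs ++ ys → _
    snd a∈ with ∈-++⁻ xs a∈
    ... | inj₁ h = inj₁ (sound E h)
    ... | inj₂ k = inj₂ (sound F k)

Image : {A B : Set} → (A → B) → (A → Set) → B → Set
Image f P b = ∃ λ a → P a × b ≡ f a

count-image : ∀ {A B : Set} {P : A → Set} {n} (f : A → B) → (∀ {a b} → f a ≡ f b → a ≡ b) →
              Count P n → Count (Image f P) n
count-image {P = P} f inj (xs , E , len) = map f xs , record
  { unique   = UniqueP.map⁺ inj (unique E)
  ; sound    = snd
  ; complete = λ { (a , Pa , refl) → ∈-map⁺ f (complete E Pa) }
  } , trans (ListP.length-map f xs) len
  where
  snd : ∀ {b} → b ∈ map f xs → Image f P b
  snd b∈ with ∈-map⁻ f b∈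
  ... | a , a∈ , eq = a , sound E a∈ , eq

-- The recursion for the open quadrant.

On-even⁻ : ∀ {s p d} → On s p d → ∀ t → s ≡ t * 2 → ∃ λ q → On t q d × p ≡ dbl q
On-even⁻ seed zero _ = origin , seed , refl
On-even⁻ (even {s} {q} D) t eq with *2-injective s t eq
... | refl = q , D , refl
On-even⁻ (odd {s} _ _) t eq = contradiction eq (odd≢even s t)

On-odd⁻ : ∀ {s p d} → On s p d → ∀ t → s ≡ suc (t * 2) →
          ∃₂ λ q e → On t q e × d ≢ opp e × p ≡ dbl q ⊕ vec d
On-odd⁻ (even {s} _) t eq = contradiction (sym eq) (odd≢even t s)
On-odd⁻ (odd {s} {q} {e} D turn) t eq with *2-injective s t (ℕP.suc-injective eq)
... | refl = q , e , D , turn , refl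

Interior : ℕ → TT → Set
Interior t (mkTT (+[1+ x ] , +[1+ y ]) d) = On t (+[1+ x ] , +[1+ y ]) d
Interior t (mkTT _ d)                     = ⊥

Interior-unique : ∀ {t} p {d e} → Interior t (mkTT p d) → Interior t (mkTT p e) → d ≡ e
Interior-unique (+[1+ x ] , +[1+ y ]) I J = proj₂ (On-unique I J (λ ()))

double : TT → TT
double (mkTT p d) = mkTT (dbl p) d

child : (Dir → Dir) → TT → TT
child k (mkTT p d) = mkTT (dbl p ⊕ vec (k d)) (k d)

child-injective : ∀ {k} → (∀ {d e} → k d ≡ k e → d ≡ e) → ∀ {a b} → child k a ≡ child k b → a ≡ b
child-injective {k} k-inj {mkTT p d} {mkTT q e} eq with k-inj (cong stem eq)
... | refl = cong (λ r → mkTT r d) (dbl-injective p q (step-cancelʳ (dbl p) (dbl q) (k d) (cong mid eq)))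

rotL-injective : ∀ {d e} → rotL d ≡ rotL e → d ≡ e
rotL-injective {up}    {up}    _ = refl
rotL-injective {down}  {down}  _ = refl
rotL-injective {left}  {left}  _ = refl
rotL-injective {right} {right} _ = refl

rotR-injective : ∀ {d e} → rotR d ≡ rotR e → d ≡ e
rotR-injective {up}    {up}    _ = refl
rotR-injective {down}  {down}  _ = refl
rotR-injective {left}  {left}  _ = refl
rotR-injective {right} {right} _ = refl

count-even : ∀ t {n} → Count (Interior t) n → Count (Interior (t * 2)) n
count-even t N = count-cong to from (count-image double
  (λ { {mkTT p d} {mkTT q e} eq → cong₂ mkTT (dbl-injective p q (cong mid eq)) (cong stem eq) }) N)
  where
  to : ∀ {c} → Image double (Interior t) c → Interior (t * 2) c
  to (mkTT (+[1+ x ] , +[1+ y ]) d , I , refl) = even I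
  from : ∀ {c} → Interior (t * 2) c → Image double (Interior t) c
  from {mkTT (+[1+ x ] , +[1+ y ]) d} I with On-even⁻ I t refl
  ... | (+[1+ i ] , +[1+ j ]) , D , eq = mkTT (+[1+ i ] , +[1+ j ]) d , D , cong (λ p → mkTT p d) eq

dbl-step-posˣ : ∀ {x} i d → +[1+ x ] ≡ (i ℤ.+ i) ℤ.+ proj₁ (vec d) → (∃ λ a → i ≡ +[1+ a ]) ⊎ (i ≡ +0 × d ≡ right)
dbl-step-posˣ +[1+ a ] d eq = inj₁ (a , refl)
dbl-step-posˣ +0 right eq = inj₂ (refl , refl)
dbl-step-posˣ +0 up ()
dbl-step-posˣ +0 down ()
dbl-step-posˣ +0 left ()
dbl-step-posˣ -[1+ a ] up ()
dbl-step-posˣ -[1+ a ] down ()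
dbl-step-posˣ -[1+ a ] left ()
dbl-step-posˣ -[1+ a ] right ()

dbl-step-posʸ : ∀ {y} j d → +[1+ y ] ≡ (j ℤ.+ j) ℤ.+ proj₂ (vec d) → (∃ λ b → j ≡ +[1+ b ]) ⊎ (j ≡ +0 × d ≡ up)
dbl-step-posʸ +[1+ b ] d eq = inj₁ (b , refl)
dbl-step-posʸ +0 up eq = inj₂ (refl , refl)
dbl-step-posʸ +0 right ()
dbl-step-posʸ +0 down ()
dbl-step-posʸ +0 left ()
dbl-step-posʸ -[1+ b ] up ()
dbl-step-posʸ -[1+ b ] down ()
dbl-step-posʸ -[1+ b ] left ()
dbl-step-posʸ -[1+ b ] right ()

-- The time `t` is positive because the two extra children, `fromX` and `fromY`, grow into the
-- quadrant from the axis cells at distance `t`; for `t = 0` both would start at the origin and stay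
-- on the axes.
module OddCount (m : ℕ) where

  t : ℕ
  t = suc m

  Straight LeftTurn RightTurn : TT → Set
  Straight  = Image (child (λ d → d)) (Interior t)
  LeftTurn  = Image (child rotL) (Interior t)
  RightTurn = Image (child rotR) (Interior t)

  fromX fromY : TT
  fromX = mkTT (dbl (+ t , +0) ⊕ vec up) up
  fromY = mkTT (dbl (+0 , + t) ⊕ vec right) right

  Children : TT → Set
  Children c = Straight c ⊎ LeftTurn c ⊎ RightTurn c ⊎ c ≡ fromX ⊎ c ≡ fromY

  -- A child determines its source: its midpoint minus its stem is the doubled source point, and a
  -- point of the quadrant has only one direction.
  images-disjoint : ∀ {k l} → (∀ d → k d ≢ l d) → ∀ {c} →
                    Image (child k) (Interior t) c → Image (child l) (Interior t) c → ⊥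
  images-disjoint {k} {l} k≢l (mkTT p d , I , refl) (mkTT q e , J , eq)
    with step-cancelʳ (dbl p) (dbl q) (k d) (trans (cong mid eq) (cong (λ f → dbl q ⊕ vec f) (sym (cong stem eq))))
  ... | p≡q with dbl-injective p q p≡q
  ...   | refl with Interior-unique p I J
  ...     | refl = k≢l d (cong stem eq)

  image-disjoint : ∀ {k} q e → (∀ d → ¬ Interior t (mkTT q d)) → ∀ {c} →
                   Image (child k) (Interior t) c → c ≢ mkTT (dbl q ⊕ vec e) e
  image-disjoint {k} q e ∉ (mkTT p d , I , refl) eq
    with step-cancelʳ (dbl p) (dbl q) (k d) (trans (cong mid eq) (cong (λ f → dbl q ⊕ vec f) (sym (cong stem eq))))
  ... | p≡q with dbl-injective p q p≡q
  ...   | refl = ∉ d I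

  axes-disjoint : ∀ {k c} → Image (child k) (Interior t) c → c ≡ fromX ⊎ c ≡ fromY → ⊥
  axes-disjoint I (inj₁ h) = image-disjoint (+ t , +0) up (λ _ ()) I h
  axes-disjoint I (inj₂ h) = image-disjoint (+0 , + t) right (λ _ ()) I h

  count-children : ∀ {n} → Count (Interior t) n → Count Children (n + (n + (n + (1 + 1))))
  count-children N =
    count-⊎ (λ { I (inj₁ J) → images-disjoint (λ d h → rotL≢ d (sym h)) I J
               ; I (inj₂ (inj₁ J)) → images-disjoint (λ d h → rotR≢ d (sym h)) I J
               ; I (inj₂ (inj₂ h)) → axes-disjoint I h })
      (count-image (child (λ d → d)) (child-injective (λ h → h)) N)
    (count-⊎ (λ { I (inj₁ J) → images-disjoint rotL≢rotR I J
                ; I (inj₂ h) → axes-disjoint I h })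
      (count-image (child rotL) (child-injective rotL-injective) N)
    (count-⊎ axes-disjoint
      (count-image (child rotR) (child-injective rotR-injective) N)
    (count-⊎ (λ { refl () }) (count-one fromX) (count-one fromY))))

  interior-child : ∀ {k} → (∀ d → k d ≢ opp d) → ∀ {c} → Image (child k) (Interior t) c → Interior (suc (t * 2)) c
  interior-child {k} turn (mkTT (+[1+ x ] , +[1+ y ]) d , I , refl) = positive (k d) (odd I (turn d))
    where
    positive : ∀ e → On (suc (t * 2)) (dbl (+[1+ x ] , +[1+ y ]) ⊕ vec e) e →
               Interior (suc (t * 2)) (mkTT (dbl (+[1+ x ] , +[1+ y ]) ⊕ vec e) e)
    positive up    D = D
    -- A doubled positive coordinate is at least two; the rewrite exposes the second successor, so
    -- one step back remains positive.
    positive down  D rewrite ℕP.+-suc y y = D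
    positive left  D rewrite ℕP.+-suc x x = D
    positive right D = D

  to : ∀ {c} → Children c → Interior (suc (t * 2)) c
  to (inj₁ I)                             = interior-child d≢opp-d I
  to (inj₂ (inj₁ I))                      = interior-child rotL≢opp I
  to (inj₂ (inj₂ (inj₁ I)))               = interior-child rotR≢opp I
  to (inj₂ (inj₂ (inj₂ (inj₁ refl))))     = odd (On-right t) (λ ())
  to (inj₂ (inj₂ (inj₂ (inj₂ refl))))     = odd (On-up t) (λ ())

  turned : ∀ p d e → Interior t (mkTT p e) → d ≢ opp e → Children (mkTT (dbl p ⊕ vec d) d)
  turned p d e I turn with compare e d
  ... | same     = inj₁ (_ , I , refl)
  ... | opposite = contradiction refl turn
  ... | turnL    = inj₂ (inj₁ (_ , I , refl))
  ... | turnR    = inj₂ (inj₂ (inj₁ (_ , I , refl)))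

  from : ∀ {c} → Interior (suc (t * 2)) c → Children c
  from {mkTT (+[1+ x ] , +[1+ y ]) d} I with On-odd⁻ I t refl
  ... | (i , j) , e , D , turn , eq with dbl-step-posˣ i d (cong proj₁ eq) | dbl-step-posʸ j d (cong proj₂ eq)
  ...   | inj₁ (a , refl) | inj₁ (b , refl) =
    subst (λ p → Children (mkTT p d)) (sym eq) (turned (+[1+ a ] , +[1+ b ]) d e D turn)
  ...   | inj₁ (a , refl) | inj₂ (refl , refl) with uniqueTime D (On-right (suc a)) refl
  ...     | refl = inj₂ (inj₂ (inj₂ (inj₁ (cong (λ p → mkTT p up) eq))))
  from {mkTT (+[1+ x ] , +[1+ y ]) d} I | (i , j) , e , D , turn , eq
        | inj₂ (refl , refl) | inj₁ (b , refl) with uniqueTime D (On-up (suc b)) refl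
  ...     | refl = inj₂ (inj₂ (inj₂ (inj₂ (cong (λ p → mkTT p right) eq))))
  from {mkTT (+[1+ x ] , +[1+ y ]) d} I | (i , j) , e , D , turn , eq
        | inj₂ (refl , refl) | inj₂ (_ , ())

  count-odd : ∀ {n} → Count (Interior t) n → Count (Interior (suc (t * 2))) (n + (n + (n + (1 + 1))))
  count-odd N = count-cong to from (count-children N)

-- Binary weight and the closed form for the quadrant.

wtAux-zero : ∀ f → wtAux f 0 ≡ 0
wtAux-zero zero    = refl
wtAux-zero (suc f) = wtAux-zero f

wtAux-fuel : ∀ f g m → m ≤ f → m ≤ g → wtAux f m ≡ wtAux g m
wtAux-fuel f g zero _ _ = trans (wtAux-zero f) (sym (wtAux-zero g))
wtAux-fuel (suc f) (suc g) m@(suc n) (s≤s n≤f) (s≤s n≤g) =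
  cong (λ w → m % 2 + w) (wtAux-fuel f g (m / 2) (ℕP.≤-trans half≤ n≤f) (ℕP.≤-trans half≤ n≤g))
  where
  half≤ : m / 2 ≤ n
  half≤ = ℕP.≤-pred (m/n<m m 2 (s≤s (s≤s z≤n)))

wt-unfold : ∀ m → wt (suc m) ≡ suc m % 2 + wt (suc m / 2)
wt-unfold m = cong (λ w → suc m % 2 + w)
  (wtAux-fuel m (suc m / 2) (suc m / 2) (ℕP.≤-pred (m/n<m (suc m) 2 (s≤s (s≤s z≤n)))) ℕP.≤-refl)

wt-even : ∀ m → wt (suc m * 2) ≡ wt (suc m)
wt-even m = trans (wt-unfold (suc (m * 2)))
  (cong₂ _+_ (m*n%n≡0 (suc m) 2) (cong wt (m*n/n≡m (suc m) 2)))

wt-odd : ∀ m → wt (suc (m * 2)) ≡ suc (wt m)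
wt-odd m = trans (wt-unfold (m * 2)) (cong₂ _+_ ([m+kn]%n≡m%n 1 m 2)
  (cong wt (trans (+-distrib-/-∣ʳ 1 {m * 2} (n∣m*n m)) (m*n/n≡m m 2))))

count-interior : ∀ t → ∃ λ n → Count (Interior (suc t)) n × 3 * suc n ≡ 3 ^ wt (suc t)
-- Time zero is excluded by an absurd equation: its quadrant is empty, but `3 * 1` is not
-- `3 ^ wt 0`.
count-interior t = binary-rec P (λ _ ()) evenStep oddStep (suc t) t refl
  where
  P : ℕ → Set
  P s = ∀ t → s ≡ suc t → ∃ λ n → Count (Interior s) n × 3 * suc n ≡ 3 ^ wt s
  evenStep : ∀ m → P (suc m) → P (suc m * 2)
  evenStep m rec _ _ with rec m refl
  ... | n , N , eq = n , count-even (suc m) N , trans eq (cong (3 ^_) (sym (wt-even m)))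
  none : Count (Interior 1) 0
  none = [] , record { unique = [] ; sound = λ () ; complete = cmp } , refl
    where
    cmp : ∀ {c} → Interior 1 c → c ∈ []
    cmp {mkTT (+[1+ x ] , +[1+ y ]) d} I with On-odd⁻ I 0 refl
    ... | q , e , D , _ , eq with On-zero D refl
    ...   | refl = ⊥-elim (vec-axis d eq)
  oddStep : ∀ m → P m → P (suc (m * 2))
  -- Time one is the true base: the neighbours of the origin all lie on the axes, and `3 * 1` equals
  -- `3 ^ wt 1`.
  oddStep zero _ _ _ = 0 , none , refl
  oddStep (suc m) rec _ _ with rec m refl
  ... | n , N , eq = n + (n + (n + 2)) , OddCount.count-odd m N ,
    trans (lem n) (trans (cong (3 *_) eq) (cong (3 ^_) (sym (wt-odd (suc m)))))
    where
    lem : ∀ n → 3 * suc (n + (n + (n + 2))) ≡ 3 * (3 * suc n)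
    lem = ℕSolver.solve-∀

-- Assembling one stage.

flip-Y move-right flip-X : TT → TT
flip-Y  (mkTT p d) = mkTT (FY.pt p) (flipDir d)
flip-X (mkTT p d) = mkTT (FX.pt p) (mirror d)
move-right  (mkTT p d) = mkTT (unshift p) d

flip-Y-injective : ∀ {a b} → flip-Y a ≡ flip-Y b → a ≡ b
flip-Y-injective eq = cong₂ mkTT (FY.pt-injective (cong mid eq)) (FY.dir-injective (cong stem eq))

flip-X-injective : ∀ {a b} → flip-X a ≡ flip-X b → a ≡ b
flip-X-injective eq = cong₂ mkTT (FX.pt-injective (cong mid eq)) (FX.dir-injective (cong stem eq))

move-right-injective : ∀ {a b} → move-right a ≡ move-right b → a ≡ b
move-right-injective {mkTT p _} {mkTT q _} eq =
  cong₂ mkTT (trans (sym (shift-unshift p)) (trans (cong shift (cong mid eq)) (shift-unshift q))) (cong stem eq)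

Side : ℕ → TT → Set
Side t (mkTT p@(+[1+ _ ] , _) d) = Cell t p d
Side t _ = ⊥

-- The offset keeps both times, `suc (suc t)` below and `suc t` in the chart above, positive as
-- `count-interior` demands. `north` is the cell on the chart's vertical axis, which the translated
-- open quadrant misses.
module SideCount (t : ℕ) where

  east north : TT
  east  = mkTT (+[1+ suc t ] , +0) right
  north = mkTT (+[1+ 0 ] , +[1+ t ]) up

  Parts : TT → Set
  Parts c = Image flip-Y (Interior (suc (suc t))) c ⊎ Image move-right (Interior (suc t)) c ⊎ c ≡ east ⊎ c ≡ north

  to : ∀ {c} → Parts c → Side (suc (suc t)) c
  to (inj₁ (mkTT (+[1+ x ] , +[1+ y ]) d , I , refl)) = FY.On-symmetric I
  to (inj₂ (inj₁ (mkTT (+[1+ x ] , +[1+ y ]) d , I , refl))) = I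
  to (inj₂ (inj₂ (inj₁ refl))) = On-right (suc (suc t)) , λ ()
  to (inj₂ (inj₂ (inj₂ refl))) = On-up (suc t)

  from : ∀ {c} → Side (suc (suc t)) c → Parts c
  from {mkTT (+[1+ x ] , -[1+ y ]) d} C = inj₁ (mkTT (+[1+ x ] , +[1+ y ]) (flipDir d) , FY.On-symmetric C ,
    cong (mkTT _) (sym (FY.dir-inv d)))
  from {mkTT (+[1+ x ] , +0) d} (C , _) with On-unique C (On-right (suc x)) (λ ())
  ... | refl , refl = inj₂ (inj₂ (inj₁ refl))
  from {mkTT (+[1+ zero ] , +[1+ y ]) d} C with On-unique C (On-up (suc y)) (λ ())
  ... | refl , refl = inj₂ (inj₂ (inj₂ refl))
  from {mkTT (+[1+ suc x ] , +[1+ y ]) d} C = inj₂ (inj₁ (mkTT (+[1+ x ] , +[1+ y ]) d , C , refl))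

  count-side : ∀ {m n} → Count (Interior (suc (suc t))) m → Count (Interior (suc t)) n →
               Count (Side (suc (suc t))) (m + (n + (1 + 1)))
  count-side M N = count-cong to from
    (count-⊎ (λ { (mkTT (+[1+ x ] , +[1+ y ]) d , _ , refl) (inj₁ (mkTT (+[1+ _ ] , +[1+ _ ]) _ , _ , ()))
                ; (mkTT (+[1+ x ] , +[1+ y ]) d , _ , refl) (inj₂ (inj₁ ()))
                ; (mkTT (+[1+ x ] , +[1+ y ]) d , _ , refl) (inj₂ (inj₂ ())) })
      (count-image flip-Y flip-Y-injective M)
    (count-⊎ (λ { (mkTT (+[1+ x ] , +[1+ y ]) d , _ , refl) (inj₁ ())
                ; (mkTT (+[1+ x ] , +[1+ y ]) d , _ , refl) (inj₂ ()) })
      (count-image move-right move-right-injective N)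
    (count-⊎ (λ { refl () }) (count-one east) (count-one north))))

module CellCount (t : ℕ) where

  T : ℕ
  T = suc (suc t)

  south : TT
  south = mkTT (+0 , -[1+ suc t ]) down

  On-down : ∀ s → On s (+0 , - (+ s)) down
  On-down s = FY.On-symmetric (On-up s)

  Parts : TT → Set
  Parts c = c ≡ south ⊎ Side T c ⊎ Image flip-X (Side T) c

  to : ∀ {c} → Parts c → At T c
  to (inj₁ refl) = On-down T
  to {mkTT (+[1+ x ] , y) d} (inj₂ (inj₁ C)) = C
  to (inj₂ (inj₂ (mkTT p@(+[1+ x ] , y) d , C , refl))) = Cell-mirror T p d C

  from : ∀ {c} → At T c → Parts c
  from {mkTT (+[1+ x ] , y) d} C = inj₂ (inj₁ C)
  from {mkTT p@(-[1+ x ] , y) d} C = inj₂ (inj₂ (mkTT (+[1+ x ] , y) (mirror d) , Cell-mirror T p d C ,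
    cong (mkTT p) (sym (FX.dir-inv d))))
  from {mkTT (+0 , +0) d} (C , _) with () ← uniqueTime C (seed {d}) refl
  from {mkTT (+0 , -[1+ y ]) d} C with On-unique C (On-down (suc y)) (λ ())
  ... | refl , refl = inj₁ refl

  count-cells : ∀ {n} → Count (Side T) n → Count (At T) (1 + (n + n))
  count-cells N = count-cong to from
    (count-⊎ (λ { refl (inj₂ (mkTT (+[1+ x ] , y) d , _ , ())) }) (count-one south)
    (count-⊎ (λ { {mkTT (+[1+ x ] , y) d} _ (mkTT (+[1+ _ ] , _) _ , _ , ()) }) N
      (count-image flip-X flip-X-injective N)))

-- Multiplying by three clears the fraction. With `m` and `n` the quadrant counts at the two times,
-- a stage has `1 + 2 (m + n + 2) = 2 ((m + 1) + (n + 1)) + 1` cells: `east` and `north` supply on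
-- each side exactly the units that turn the counts into powers of three.
theorem10 : (τ 1 ≡ 1) × (τ 2 ≡ 3) × ((n : ℕ) → 3 ≤ n → 3 * τ n ≡ 2 * (3 ^ wt (n ∸ 1) + 3 ^ wt (n ∸ 2)) + 3)
theorem10 = refl , refl , main
  where
  main : ∀ n → 3 ≤ n → 3 * τ n ≡ 2 * (3 ^ wt (n ∸ 1) + 3 ^ wt (n ∸ 2)) + 3
  main (suc (suc (suc t))) _ with count-interior (suc t) | count-interior t
  ... | m , M , m≡ | n , N , n≡ with CellCount.count-cells t (SideCount.count-side t M N)
  ...   | xs , E , len = begin
    3 * τ (suc (suc (suc t)))                          ≡⟨ cong (3 *_) (trans count len) ⟩
    3 * (1 + ((m + (n + 2)) + (m + (n + 2))))          ≡⟨ lem m n ⟩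
    2 * (3 * suc m + 3 * suc n) + 3                    ≡⟨ cong₂ (λ a b → 2 * (a + b) + 3) m≡ n≡ ⟩
    2 * (3 ^ wt (suc (suc t)) + 3 ^ wt (suc t)) + 3    ∎
    where
    open ≡-Reasoning
    count : τ (suc (suc (suc t))) ≡ length xs
    count = enumerations-equinumerous (grow-enumerates (structure-enumerates (suc t))) E
    lem : ∀ m n → 3 * (1 + ((m + (n + 2)) + (m + (n + 2)))) ≡ 2 * (3 * suc m + 3 * suc n) + 3
    lem = ℕSolver.solve-∀
  main (suc (suc zero)) (s≤s (s≤s ()))
  main (suc zero) (s≤s ())
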